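{- Let $M\ge N\ge1$ and $D\ge1$ be integers and let $\mathcal R=\mathbb R[t]/(t^D)$. Let $A,Q\in\mathcal R^{M\times N}$ and $R\in\mathcal R^{N\times N}$ with $R$ invertible satisfy the QR system $$A=QR,\qquad Q^TQ=I,\qquad P_L\circ R=0 .$$ Let $\bar Q\in\mathcal R^{M\times N}$ and $\bar R\in\mathcal R^{N\times N}$ be arbitrary and define $$\bar A:=Q\Big(\bar R+\big(P_L\circ\big(R\bar R^T-\bar RR^T+Q^T\bar Q-\bar Q^TQ\big)\big)R^{ -T}\Big)+\big(\bar Q-QQ^T\bar Q\big)R^{ -T}.$$ Then for all differentials $\mathrm dA,\mathrm dQ\in\mathcal R^{M\times N}$, $\mathrm dR\in\mathcal R^{N\times N}$ satisfying the differentiated QR system $$\mathrm dA=\mathrm dQ\,R+Q\,\mathrm dR,\qquad \mathrm dQ^TQ+Q^T\mathrm dQ=0,\qquad P_L\circ \mathrm dR=0,$$ one has $$\operatorname{tr}(\bar A^T\mathrm dA)=\operatorname{tr}(\bar Q^T\mathrm dQ)+\operatorname{tr}(\bar R^T\mathrm dR)\quad\text{in }\mathcal R .$$ Moreover, if $M=N$, the last term $(\bar Q-QQ^T\bar Q)R^{ -T}$ vanishes.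
   Context: Matrices over $\mathcal R=\mathbb R[t]/(t^D)$ are identified with polynomials $\sum_{d=0}^{D-1}X_dt^d$ with real matrix coefficients, multiplied modulo $t^D$. The case $D=1$ is the ordinary real case. $\circ$ is the Hadamard (entrywise) product. $P_L\in\mathbb R^{N\times N}$ has $(P_L)_{ij}=1$ if $i>j$ and $0$ otherwise, so $P_L\circ R=0$ means $R$ is upper triangular. $I$ is the identity matrix and $R^{ -T}=(R^{ -1})^T$. The pullback of the QR decomposition $A\mapsto(Q,R)$ is the map computing the adjoint $\bar A$ of the input from the adjoints $\bar Q,\bar R$ of the outputs so that the trace identity $\operatorname{tr}(\bar A^T\mathrm dA)=\operatorname{tr}(\bar Q^T\mathrm dQ)+\operatorname{tr}(\bar R^T\mathrm dR)$ holds for all differentials $\mathrm dA,\mathrm dQ,\mathrm dR$ satisfying the differentiated QR system $\mathrm dA=\mathrm dQ\,R+Q\,\mathrm dR$, $\mathrm dQ^TQ+Q^T\mathrm dQ=0$, $P_L\circ\mathrm dR=0$. -}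

module Defs where

open import Algebra.Bundles using (RawRing)
import Algebra.Definitions as AlgebraDefinitions
import Algebra.Definitions.RawMonoid as RawMonoidDefinitions
open import Data.Bool.Base using (if_then_else_)
open import Data.Fin.Base using (Fin; zero; suc; toℕ; inject≤; opposite)
open import Data.Fin.Properties using (_<?_; _≟_; toℕ<n)
open import Data.Nat.Base as ℕ using (ℕ)
import Data.Nat.Properties as ℕ
open import Data.Product.Base using (∃-syntax; _×_; _,_; proj₁; proj₂)
open import Data.Vec.Functional using (Vector; zipWith; map; replicate; transpose)
open import Level using (0ℓ)
open import Relation.Binary.PropositionalEquality
  using (_≡_; refl; sym; trans; cong; subst)
open import Relation.Nullary.Decidable using (does)

------------------------------------------------------------------------
-- K[t]/(t^D): an element is the vector of the coefficients of
-- t^0, …, t^(D-1).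

infix 10 _[t]/t^_

_[t]/t^_ : ∀ {c ℓ} → RawRing c ℓ → ℕ → RawRing c ℓ
K [t]/t^ D = record
  { Carrier = Vector K.Carrier D
  ; _≈_     = λ p q → ∀ d → p d K.≈ q d
  ; _+_     = zipWith K._+_
  ; _*_     = _·_
  ; -_      = map K.-_
  ; 0#      = replicate D K.0#
  ; 1#      = one
  }
  where
  module K = RawRing K
  open RawMonoidDefinitions K.+-rawMonoid using (sum)

  -- (p · q)_d is the sum of p_i q_(d-i) over i = 0, …, d; the index
  -- opposite i in Fin (d + 1) has the value d - i.
  _·_ : Vector K.Carrier D → Vector K.Carrier D → Vector K.Carrier D
  (p · q) d = sum {ℕ.suc (toℕ d)} λ i →
    p (inject≤ i (toℕ<n d)) K.* q (inject≤ (opposite i) (toℕ<n d))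

  one : ∀ {n} → Vector K.Carrier n
  one zero    = K.1#
  one (suc _) = K.0#

------------------------------------------------------------------------

module Matrices {c ℓ} (𝓡 : RawRing c ℓ) where

  open RawRing 𝓡 public
  open RawMonoidDefinitions +-rawMonoid using (sum)

  infix  4 _≈ᴹ_
  infixl 6 _+ᴹ_ _-ᴹ_
  infixl 7 _*ᴹ_ _∘ᴹ_
  infix  8 -ᴹ_
  infix  9 _ᵀ

  Matrix : ℕ → ℕ → Set c
  Matrix m n = Vector (Vector Carrier n) m

  _≈ᴹ_ : ∀ {m n} → Matrix m n → Matrix m n → Set ℓ
  X ≈ᴹ Y = ∀ i j → X i j ≈ Y i j

  0ᴹ : ∀ {m n} → Matrix m n
  0ᴹ i j = 0#

  I : ∀ {n} → Matrix n n
  I i j = if does (i ≟ j) then 1# else 0#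

  _+ᴹ_ : ∀ {m n} → Matrix m n → Matrix m n → Matrix m n
  (X +ᴹ Y) i j = X i j + Y i j

  -ᴹ_ : ∀ {m n} → Matrix m n → Matrix m n
  (-ᴹ X) i j = - X i j

  _-ᴹ_ : ∀ {m n} → Matrix m n → Matrix m n → Matrix m n
  X -ᴹ Y = X +ᴹ (-ᴹ Y)

  _*ᴹ_ : ∀ {m k n} → Matrix m k → Matrix k n → Matrix m n
  (X *ᴹ Y) i j = sum λ l → X i l * Y l j

  _∘ᴹ_ : ∀ {m n} → Matrix m n → Matrix m n → Matrix m n
  (X ∘ᴹ Y) i j = X i j * Y i j

  _ᵀ : ∀ {m n} → Matrix m n → Matrix n m
  X ᵀ = transpose X

  tr : ∀ {n} → Matrix n n → Carrier
  tr X = sum λ i → X i i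

  -- The strictly lower triangular mask, as a matrix over 𝓡.
  Pᴸ : ∀ {n} → Matrix n n
  Pᴸ i j = if does (j <? i) then 1# else 0#

  Invertible : ∀ {n} → Matrix n n → Set _
  Invertible = AlgebraDefinitions.Invertible _≈ᴹ_ I _*ᴹ_

  inverse : ∀ {n} (X : Matrix n n) → Invertible X → Matrix n n
  inverse X = proj₁

------------------------------------------------------------------------
-- The real numbers, by Cantor's construction: Cauchy sequences of
-- rationals, two of them being equal when their difference tends to 0.

open import Data.Rational.Base as ℚ
  using (ℚ; 0ℚ; 1ℚ; ½; _+_; _*_; -_; _-_; ∣_∣; _<_; 1/_)
import Data.Rational.Properties as ℚ
open import Data.Rational.Solver using (module +-*-Solver)

IsCauchy : (ℕ → ℚ) → Set
IsCauchy x = ∀ ε → 0ℚ < ε →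
  ∃[ K ] (∀ m n → K ℕ.≤ m → K ℕ.≤ n → ∣ x m - x n ∣ < ε)

record ℝ : Set where
  constructor mkℝ
  field
    seq    : ℕ → ℚ
    cauchy : IsCauchy seq

open ℝ public

infix 4 _≃_

_≃_ : ℝ → ℝ → Set
x ≃ y = ∀ ε → 0ℚ < ε →
  ∃[ K ] (∀ n → K ℕ.≤ n → ∣ seq x n - seq y n ∣ < ε)

private
  open +-*-Solver using (solve; _:+_; _:*_; _:-_; :-_; _:=_)

  half>0 : ∀ {ε} → 0ℚ < ε → 0ℚ < ½ * ε
  half>0 {ε} ε>0 = subst (_< ½ * ε) (ℚ.*-zeroʳ ½) (ℚ.*-monoʳ-<-pos ½ ε>0)

  half+half : ∀ ε → ½ * ε + ½ * ε ≡ ε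
  half+half ε = trans (sym (ℚ.*-distribʳ-+ ε ½ ½)) (ℚ.*-identityˡ ε)

  triangle : ∀ {a b c d r} → a ≡ b + c → ∣ b ∣ < d → ∣ c ∣ < r → ∣ a ∣ < d + r
  triangle {b = b} {c} refl b<d c<r =
    ℚ.≤-<-trans (ℚ.∣p+q∣≤∣p∣+∣q∣ b c) (ℚ.+-mono-< b<d c<r)

  const-cauchy : ∀ q → IsCauchy (λ _ → q)
  const-cauchy q ε ε>0 =
    0 , λ _ _ _ _ → subst (_< ε) (sym (cong ∣_∣ (ℚ.+-inverseʳ q))) ε>0

  +-cauchy : ∀ {x y} → IsCauchy x → IsCauchy y → IsCauchy (λ n → x n + y n)
  +-cauchy {x} {y} cx cy ε ε>0
    with cx (½ * ε) (half>0 ε>0) | cy (½ * ε) (half>0 ε>0)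
  ... | K , p | L , q = K ℕ.+ L , λ m n hm hn →
    subst (∣ (x m + y m) - (x n + y n) ∣ <_) (half+half ε)
      (triangle (rearrange (x m) (y m) (x n) (y n))
        (p m n (ℕ.m+n≤o⇒m≤o K hm) (ℕ.m+n≤o⇒m≤o K hn))
        (q m n (ℕ.m+n≤o⇒n≤o K hm) (ℕ.m+n≤o⇒n≤o K hn)))
    where
    rearrange : ∀ a b c d → (a + b) - (c + d) ≡ (a - c) + (b - d)
    rearrange = solve 4
      (λ a b c d → (a :+ b) :- (c :+ d) := (a :- c) :+ (b :- d)) refl

  neg-cauchy : ∀ {x} → IsCauchy x → IsCauchy (λ n → - x n)
  neg-cauchy {x} cx ε ε>0 with cx ε ε>0
  ... | K , p = K , λ m n hm hn →
    subst (_< ε)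
      (trans (sym (ℚ.∣-p∣≡∣p∣ (x m - x n))) (cong ∣_∣ (ℚ.neg-distrib-+ (x m) (- x n))))
      (p m n hm hn)

  eventually-bounded : ∀ {x} → IsCauchy x →
    ∃[ B ] 0ℚ < B × ∃[ K ] (∀ n → K ℕ.≤ n → ∣ x n ∣ < B)
  eventually-bounded {x} cx with cx 1ℚ (ℚ.positive⁻¹ 1ℚ)
  ... | K , p =
    ∣ x K ∣ + 1ℚ
    , ℚ.+-mono-≤-< (ℚ.0≤∣p∣ (x K)) (ℚ.positive⁻¹ 1ℚ)
    , K , λ n hn → ℚ.≤-<-trans
        (subst (λ z → ∣ z ∣ ℚ.≤ ∣ x K ∣ + ∣ x n - x K ∣) (rearrange (x K) (x n))
          (ℚ.∣p+q∣≤∣p∣+∣q∣ (x K) (x n - x K)))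
        (ℚ.+-monoʳ-< ∣ x K ∣ (p n K hn ℕ.≤-refl))
    where
    rearrange : ∀ a b → a + (b - a) ≡ b
    rearrange = solve 2 (λ a b → a :+ (b :- a) := b) refl

  *-bound : ∀ {a b c d} → 0ℚ < c → ∣ a ∣ < c → ∣ b ∣ < d → ∣ a * b ∣ < c * d
  *-bound {a} {b} {c} {d} c>0 a<c b<d =
    subst (_< c * d) (sym (ℚ.∣p*q∣≡∣p∣*∣q∣ a b))
      (ℚ.≤-<-trans
        (ℚ.*-monoʳ-≤-nonNeg ∣ b ∣ {{ℚ.∣-∣-nonNeg b}} (ℚ.<⇒≤ a<c))
        (ℚ.*-monoʳ-<-pos c {{ℚ.positive c>0}} b<d))

  divide : ∀ {s ε} → 0ℚ < s → 0ℚ < ε → ∃[ δ ] 0ℚ < δ × s * δ ≡ ε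
  divide {s} {ε} s>0 ε>0 =
    (1/ s) * ε
    , subst (_< (1/ s) * ε) (ℚ.*-zeroʳ (1/ s))
        (ℚ.*-monoʳ-<-pos (1/ s) {{ℚ.1/pos⇒pos s}} ε>0)
    , trans (sym (ℚ.*-assoc s (1/ s) ε))
        (trans (cong (_* ε) (ℚ.*-inverseʳ s)) (ℚ.*-identityˡ ε))
    where
    instance
      s-positive : ℚ.Positive s
      s-positive = ℚ.positive s>0
      s-nonZero : ℚ.NonZero s
      s-nonZero = ℚ.pos⇒nonZero s

  *-cauchy : ∀ {x y} → IsCauchy x → IsCauchy y → IsCauchy (λ n → x n * y n)
  *-cauchy {x} {y} cx cy ε ε>0 =
    let B , B>0 , K₁ , p₁ = eventually-bounded {x} cx
        C , C>0 , K₂ , p₂ = eventually-bounded {y} cy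
        δ , δ>0 , split   = divide (ℚ.+-mono-< B>0 C>0) ε>0
        K₃ , p₃           = cx δ δ>0
        K₄ , p₄           = cy δ δ>0
    in combine B C δ (trans (sym (ℚ.*-distribʳ-+ δ B C)) split)
         B>0 C>0 K₁ K₂ K₃ K₄ p₁ p₂ p₃ p₄
    where
    rearrange : ∀ a b c d → a * b - c * d ≡ a * (b - d) + d * (a - c)
    rearrange = solve 4
      (λ a b c d → a :* b :- c :* d := a :* (b :- d) :+ d :* (a :- c)) refl

    combine : ∀ B C δ → B * δ + C * δ ≡ ε → 0ℚ < B → 0ℚ < C → ∀ K₁ K₂ K₃ K₄ →
      (∀ n → K₁ ℕ.≤ n → ∣ x n ∣ < B) →
      (∀ n → K₂ ℕ.≤ n → ∣ y n ∣ < C) →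
      (∀ m n → K₃ ℕ.≤ m → K₃ ℕ.≤ n → ∣ x m - x n ∣ < δ) →
      (∀ m n → K₄ ℕ.≤ m → K₄ ℕ.≤ n → ∣ y m - y n ∣ < δ) →
      ∃[ K ] (∀ m n → K ℕ.≤ m → K ℕ.≤ n → ∣ x m * y m - x n * y n ∣ < ε)
    combine B C δ split B>0 C>0 K₁ K₂ K₃ K₄ p₁ p₂ p₃ p₄ =
      (K₁ ℕ.+ K₂) ℕ.+ (K₃ ℕ.+ K₄) , λ m n hm hn →
      let m₁₂ = ℕ.m+n≤o⇒m≤o (K₁ ℕ.+ K₂) hm
          m₃₄ = ℕ.m+n≤o⇒n≤o (K₁ ℕ.+ K₂) hm
          n₁₂ = ℕ.m+n≤o⇒m≤o (K₁ ℕ.+ K₂) hn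
          n₃₄ = ℕ.m+n≤o⇒n≤o (K₁ ℕ.+ K₂) hn
      in subst (∣ x m * y m - x n * y n ∣ <_) split
        (triangle (rearrange (x m) (y m) (x n) (y n))
          (*-bound B>0 (p₁ m (ℕ.m+n≤o⇒m≤o K₁ m₁₂))
            (p₄ m n (ℕ.m+n≤o⇒n≤o K₃ m₃₄) (ℕ.m+n≤o⇒n≤o K₃ n₃₄)))
          (*-bound C>0 (p₂ n (ℕ.m+n≤o⇒n≤o K₁ n₁₂))
            (p₃ m n (ℕ.m+n≤o⇒m≤o K₃ m₃₄) (ℕ.m+n≤o⇒m≤o K₃ n₃₄))))

fromℚ : ℚ → ℝ
fromℚ q = mkℝ (λ _ → q) (const-cauchy q)

infixl 6 _+ℝ_
infixl 7 _*ℝ_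

_+ℝ_ : ℝ → ℝ → ℝ
x +ℝ y = mkℝ (λ n → seq x n + seq y n) (+-cauchy {seq x} {seq y} (cauchy x) (cauchy y))

_*ℝ_ : ℝ → ℝ → ℝ
x *ℝ y = mkℝ (λ n → seq x n * seq y n) (*-cauchy {seq x} {seq y} (cauchy x) (cauchy y))

-ℝ_ : ℝ → ℝ
-ℝ x = mkℝ (λ n → - seq x n) (neg-cauchy {seq x} (cauchy x))

ℝ-rawRing : RawRing 0ℓ 0ℓ
ℝ-rawRing = record
  { Carrier = ℝ
  ; _≈_     = _≃_
  ; _+_     = _+ℝ_
  ; _*_     = _*ℝ_
  ; -_      = -ℝ_
  ; 0#      = fromℚ 0ℚ
  ; 1#      = fromℚ 1ℚ
  }

{-# OPTIONS --safe #-}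

-- Write ⟨X, Y⟩ = tr(XᵀY), Ω = Qᵀ dQ and V = R̄Rᵀ - QᵀQ̄.  The masked matrix in
-- Ā is Vᵀ - V and Ω is skew, so ⟨P_L ∘ (Vᵀ - V), Ω⟩ = -⟨V, Ω⟩ (this needs
-- Ω to have zero diagonal, hence no 2-torsion).  The part of Ā along Q meets
-- Qᵀ dA = ΩR + dR, where the contribution of dR R⁻¹ against P_L ∘ (Vᵀ - V)
-- vanishes because R⁻¹ is again upper triangular; the remaining part sees
-- only dQ, because (I - QQᵀ)Q = 0.
--
-- For M = N, the matrix E = I - QQᵀ is symmetric and idempotent with
-- tr E = tr I - tr(QᵀQ) = 0, so Σ Eᵢⱼ² = tr(EᵀE) = 0.  Its constant
-- coefficient is a vanishing sum of real squares, so E has no constant term,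
-- and E = E² then kills all higher coefficients.

module Submission where

open import Defs
open import Data.Nat.Base using (ℕ; _≤_)
open import Data.Product.Base using (_×_)
open import Relation.Binary.PropositionalEquality using (_≡_)

open import Algebra.Bundles using (AbelianGroup; CommutativeRing; RawRing)
import Algebra.Consequences.Setoid as Consequences
import Algebra.Construct.Pointwise as Pointwise
import Algebra.Definitions.RawMonoid as RawMonoidDefinitions
import Algebra.Properties.Ring as RingProperties
import Algebra.Properties.Semiring.Sum as SemiringSum
import Algebra.Solver.CommutativeMonoid as CommutativeMonoidSolver
open import Algebra.Structures using (IsAbelianGroup; IsCommutativeRing)
open import Data.Fin.Base as Fin using (Fin; zero; suc; toℕ; inject≤; opposite)
import Data.Fin.Properties as Fin
import Data.Nat.Base as ℕ
import Data.Nat.Properties as ℕ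
open import Data.Product.Base using (∃-syntax; _,_)
open import Data.Rational.Base as ℚ using (ℚ; 0ℚ; 1ℚ; ½)
import Data.Rational.Properties as ℚ
open import Data.Rational.Solver using (module +-*-Solver)
open import Data.Sum.Base using (inj₁; inj₂)
open import Data.Vec.Functional using (Vector)
open import Function.Base using (_∘_; flip)
open import Level using (0ℓ; _⊔_)
open import Relation.Binary.Bundles using (Setoid)
open import Relation.Binary.Definitions using (tri<; tri≈; tri>)
open import Relation.Binary.PropositionalEquality as ≡ using (_≢_)
open import Relation.Binary.Structures using (IsEquivalence)
open import Relation.Nullary.Decidable using (yes; no; dec-true; dec-false)

-- The ring of real numbers

module RealRing where

  open import Data.Rational.Base using (_+_; _*_; -_; _-_; ∣_∣; _<_; 1/_)
  open ≡ using (refl; sym; trans; cong; subst)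
  open +-*-Solver using (solve; _:+_; _:*_; _:-_; :-_; _:=_)

  -- By definition `x ≃ y` is `Null` of the termwise difference, so congruence of the real
  -- operations reduces to closure properties of null sequences.
  Null : (ℕ → ℚ) → Set
  Null f = ∀ ε → 0ℚ < ε → ∃[ K ] (∀ n → K ℕ.≤ n → ∣ f n ∣ < ε)

  Bounded : (ℕ → ℚ) → Set
  Bounded f = ∃[ B ] 0ℚ < B × ∃[ K ] (∀ n → K ℕ.≤ n → ∣ f n ∣ < B)

  null-mono : ∀ {f g} → (∀ n → ∣ g n ∣ ℚ.≤ ∣ f n ∣) → Null f → Null g
  null-mono g≤f nf ε ε>0 with nf ε ε>0
  ... | K , p = K , λ n K≤n → ℚ.≤-<-trans (g≤f n) (p n K≤n)

  null-cong : ∀ {f g} → (∀ n → f n ≡ g n) → Null f → Null g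
  null-cong f≗g = null-mono (λ n → ℚ.≤-reflexive (cong ∣_∣ (sym (f≗g n))))

  null-zero : ∀ {f} → (∀ n → f n ≡ 0ℚ) → Null f
  null-zero f≗0 ε ε>0 = 0 , λ n _ → subst (λ q → ∣ q ∣ < ε) (sym (f≗0 n)) ε>0

  null-neg : ∀ {f} → Null f → Null (λ n → - f n)
  null-neg {f} = null-mono (λ n → ℚ.≤-reflexive (ℚ.∣-p∣≡∣p∣ (f n)))

  null-+ : ∀ {f g} → Null f → Null g → Null (λ n → f n + g n)
  null-+ {f} {g} nf ng ε ε>0 with nf (½ * ε) ½ε>0 | ng (½ * ε) ½ε>0
    where
    ½ε>0 : 0ℚ < ½ * ε
    ½ε>0 = subst (_< ½ * ε) (ℚ.*-zeroʳ ½) (ℚ.*-monoʳ-<-pos ½ ε>0)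
  ... | K , p | L , q = K ℕ.+ L , λ n h →
    subst (∣ f n + g n ∣ <_)
      (trans (sym (ℚ.*-distribʳ-+ ε ½ ½)) (ℚ.*-identityˡ ε))
      (ℚ.≤-<-trans (ℚ.∣p+q∣≤∣p∣+∣q∣ (f n) (g n))
        (ℚ.+-mono-< (p n (ℕ.m+n≤o⇒m≤o K h)) (q n (ℕ.m+n≤o⇒n≤o K h))))

  divide : ∀ {b ε} → 0ℚ < b → 0ℚ < ε → ∃[ δ ] 0ℚ < δ × b * δ ≡ ε
  divide {b} {ε} b>0 ε>0 = 1/ b * ε
    , subst (_< 1/ b * ε) (ℚ.*-zeroʳ (1/ b))
        (ℚ.*-monoʳ-<-pos (1/ b) {{ℚ.1/pos⇒pos b}} ε>0)
    , trans (sym (ℚ.*-assoc b (1/ b) ε))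
        (trans (cong (_* ε) (ℚ.*-inverseʳ b)) (ℚ.*-identityˡ ε))
    where
    instance
      b-positive : ℚ.Positive b
      b-positive = ℚ.positive b>0
      b-nonZero : ℚ.NonZero b
      b-nonZero = ℚ.pos⇒nonZero b

  -- With `B` an eventual bound of `f`, the tolerance `ε / B` for `g` gives tolerance `ε` for the
  -- product.
  null-* : ∀ {f g} → Bounded f → Null g → Null (λ n → f n * g n)
  null-* {f} {g} (B , B>0 , K , f<B) ng ε ε>0 =
    let δ , δ>0 , Bδ≡ε = divide B>0 ε>0
        L , g<δ        = ng δ δ>0
    in K ℕ.+ L , λ n h → subst (∣ f n * g n ∣ <_) Bδ≡ε
      (subst (_< B * δ) (sym (ℚ.∣p*q∣≡∣p∣*∣q∣ (f n) (g n)))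
        (ℚ.≤-<-trans
          (ℚ.*-monoʳ-≤-nonNeg ∣ g n ∣ {{ℚ.∣-∣-nonNeg (g n)}}
            (ℚ.<⇒≤ (f<B n (ℕ.m+n≤o⇒m≤o K h))))
          (ℚ.*-monoʳ-<-pos B {{ℚ.positive B>0}} (g<δ n (ℕ.m+n≤o⇒n≤o K h)))))

  -- From some index `K` on, all terms lie within 1 of `f K`.
  cauchy⇒bounded : ∀ {f} → IsCauchy f → Bounded f
  cauchy⇒bounded {f} cf with cf 1ℚ (ℚ.positive⁻¹ 1ℚ)
  ... | K , p =
    ∣ f K ∣ + 1ℚ
    , ℚ.+-mono-≤-< (ℚ.0≤∣p∣ (f K)) (ℚ.positive⁻¹ 1ℚ)
    , K , λ n K≤n → ℚ.≤-<-trans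
        (subst (λ q → ∣ q ∣ ℚ.≤ ∣ f K ∣ + ∣ f n - f K ∣) (cancel (f K) (f n))
          (ℚ.∣p+q∣≤∣p∣+∣q∣ (f K) (f n - f K)))
        (ℚ.+-monoʳ-< ∣ f K ∣ (p n K K≤n ℕ.≤-refl))
    where
    cancel : ∀ a b → a + (b - a) ≡ b
    cancel = solve 2 (λ a b → a :+ (b :- a) := b) refl

  -- The real operations act term by term, so each ring law of ℚ holds exactly at every index; this
  -- carries it over to ℝ.
  ≗⇒≃ : ∀ {x y} → (∀ n → seq x n ≡ seq y n) → x ≃ y
  ≗⇒≃ {x} {y} x≗y = null-zero λ n →
    trans (cong (_- seq y n) (x≗y n)) (ℚ.+-inverseʳ (seq y n))

  ≃-isEquivalence : IsEquivalence _≃_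
  ≃-isEquivalence = record
    { refl  = λ {x} → ≗⇒≃ {x} {x} λ _ → refl
    ; sym   = λ {x} {y} x≃y → null-cong (λ n → swap (seq x n) (seq y n)) (null-neg x≃y)
    ; trans = λ {x} {y} {z} x≃y y≃z →
        null-cong (λ n → telescope (seq x n) (seq y n) (seq z n)) (null-+ x≃y y≃z)
    }
    where
    swap : ∀ a b → - (a - b) ≡ b - a
    swap = solve 2 (λ a b → :- (a :- b) := b :- a) refl
    telescope : ∀ a b c → (a - b) + (b - c) ≡ a - c
    telescope = solve 3 (λ a b c → (a :- b) :+ (b :- c) := a :- c) refl

  +ℝ-cong : ∀ {x y u v} → x ≃ y → u ≃ v → x +ℝ u ≃ y +ℝ v
  +ℝ-cong {x} {y} {u} {v} x≃y u≃v =
    null-cong (λ n → rearrange (seq x n) (seq y n) (seq u n) (seq v n)) (null-+ x≃y u≃v)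
    where
    rearrange : ∀ a b c d → (a - b) + (c - d) ≡ (a + c) - (b + d)
    rearrange = solve 4
      (λ a b c d → (a :- b) :+ (c :- d) := (a :+ c) :- (b :+ d)) refl

  *ℝ-cong : ∀ {x y u v} → x ≃ y → u ≃ v → x *ℝ u ≃ y *ℝ v
  *ℝ-cong {x} {y} {u} {v} x≃y u≃v =
    -- xu - yv = u(x - y) + y(u - v): each null difference is multiplied by a bounded Cauchy
    -- sequence.
    null-cong (λ n → rearrange (seq x n) (seq y n) (seq u n) (seq v n))
      (null-+ (null-* {seq u} (cauchy⇒bounded (cauchy u)) x≃y)
              (null-* {seq y} (cauchy⇒bounded (cauchy y)) u≃v))
    where
    rearrange : ∀ a b c d → c * (a - b) + b * (c - d) ≡ a * c - b * d
    rearrange = solve 4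
      (λ a b c d → c :* (a :- b) :+ b :* (c :- d) := a :* c :- b :* d) refl

  -ℝ-cong : ∀ {x y} → x ≃ y → -ℝ x ≃ -ℝ y
  -ℝ-cong {x} {y} x≃y =
    null-cong (λ n → ℚ.neg-distrib-+ (seq x n) (- seq y n)) (null-neg x≃y)

  ≃-setoid : Setoid 0ℓ 0ℓ
  ≃-setoid = record { isEquivalence = ≃-isEquivalence }

  open Consequences ≃-setoid

  +ℝ-comm : ∀ x y → x +ℝ y ≃ y +ℝ x
  +ℝ-comm x y = ≗⇒≃ {x +ℝ y} {y +ℝ x} λ n → ℚ.+-comm (seq x n) (seq y n)

  *ℝ-comm : ∀ x y → x *ℝ y ≃ y *ℝ x
  *ℝ-comm x y = ≗⇒≃ {x *ℝ y} {y *ℝ x} λ n → ℚ.*-comm (seq x n) (seq y n)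

  +ℝ-isAbelianGroup : IsAbelianGroup _≃_ _+ℝ_ (fromℚ 0ℚ) -ℝ_
  +ℝ-isAbelianGroup = record
    { isGroup = record
      { isMonoid = record
        { isSemigroup = record
          { isMagma = record
            { isEquivalence = ≃-isEquivalence
            ; ∙-cong        = λ {x} {y} {u} {v} → +ℝ-cong {x} {y} {u} {v}
            }
          ; assoc = λ x y z → ≗⇒≃ {(x +ℝ y) +ℝ z} {x +ℝ (y +ℝ z)}
              λ n → ℚ.+-assoc (seq x n) (seq y n) (seq z n)
          }
        ; identity = comm∧idˡ⇒id {_∙_ = _+ℝ_} +ℝ-comm {fromℚ 0ℚ}
            λ x → ≗⇒≃ {fromℚ 0ℚ +ℝ x} {x} λ n → ℚ.+-identityˡ (seq x n)
        }
      ; inverse = comm∧invˡ⇒inv {_+ℝ_} { -ℝ_} {fromℚ 0ℚ} +ℝ-comm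
          λ x → ≗⇒≃ {(-ℝ x) +ℝ x} {fromℚ 0ℚ} λ n → ℚ.+-inverseˡ (seq x n)
      ; ⁻¹-cong = λ {x} {y} → -ℝ-cong {x} {y}
      }
    ; comm = +ℝ-comm
    }

  ℝ-isCommutativeRing :
    IsCommutativeRing _≃_ _+ℝ_ _*ℝ_ -ℝ_ (fromℚ 0ℚ) (fromℚ 1ℚ)
  ℝ-isCommutativeRing = record
    { isRing = record
      { +-isAbelianGroup = +ℝ-isAbelianGroup
      ; *-cong     = λ {x} {y} {u} {v} → *ℝ-cong {x} {y} {u} {v}
      ; *-assoc    = λ x y z → ≗⇒≃ {(x *ℝ y) *ℝ z} {x *ℝ (y *ℝ z)}
          λ n → ℚ.*-assoc (seq x n) (seq y n) (seq z n)
      ; *-identity = comm∧idˡ⇒id {_∙_ = _*ℝ_} *ℝ-comm {fromℚ 1ℚ}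
          λ x → ≗⇒≃ {fromℚ 1ℚ *ℝ x} {x} λ n → ℚ.*-identityˡ (seq x n)
      ; distrib    = comm∧distrˡ⇒distr {_*ℝ_} {_+ℝ_}
          (λ {x} {y} {u} {v} → +ℝ-cong {x} {y} {u} {v}) *ℝ-comm
          λ x y z → ≗⇒≃ {x *ℝ (y +ℝ z)} {x *ℝ y +ℝ x *ℝ z}
            λ n → ℚ.*-distribˡ-+ (seq x n) (seq y n) (seq z n)
      }
    ; *-comm = *ℝ-comm
    }

ℝ-commutativeRing : CommutativeRing 0ℓ 0ℓ
ℝ-commutativeRing = record { isCommutativeRing = RealRing.ℝ-isCommutativeRing }

-- Halving, and sums of squares of real numbers

module RealProperties where

  open import Data.Rational.Base using (_+_; _*_; _-_; ∣_∣; _<_)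
  open ≡ using (refl; sym; trans; cong; subst; subst₂)
  open +-*-Solver using (solve; _:*_; :-_; _:=_)
  open RealRing using (Null; null-mono; ≗⇒≃)
  open CommutativeRing ℝ-commutativeRing using (setoid; *-cong; zeroʳ) renaming (refl to ≃-refl)
  open RawMonoidDefinitions (RawRing.+-rawMonoid ℝ-rawRing) using (sum)

  2-torsion-free : ∀ x → x +ℝ x ≃ fromℚ 0ℚ → x ≃ fromℚ 0ℚ
  2-torsion-free x x+x≃0 = begin
    x                  ≈⟨ ≗⇒≃ {x} {h *ℝ (x +ℝ x)} (λ n → halve (seq x n)) ⟩
    h *ℝ (x +ℝ x)      ≈⟨ *-cong {h} {h} {x +ℝ x} {fromℚ 0ℚ} (≃-refl {h}) x+x≃0 ⟩
    h *ℝ fromℚ 0ℚ      ≈⟨ zeroʳ h ⟩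
    fromℚ 0ℚ           ∎
    where
    open import Relation.Binary.Reasoning.Setoid setoid
    h = fromℚ ½
    halve : ∀ q → q ≡ ½ * (q + q)
    halve q = trans (sym (ℚ.*-identityˡ q))
      (trans (ℚ.*-distribʳ-+ q ½ ½) (sym (ℚ.*-distribˡ-+ ½ q q)))

  -- A condition on the representing sequence, stronger than x ≥ 0 and not invariant under `≃`.
  -- Squares and their sums satisfy it exactly, which permits termwise comparison.
  NonNegative : ℝ → Set
  NonNegative x = ∀ n → 0ℚ ℚ.≤ seq x n

  sum-nonNegative : ∀ {n} {v : Fin n → ℝ} → (∀ i → NonNegative (v i)) → NonNegative (sum v)
  sum-nonNegative {ℕ.zero}  v≥0 k = ℚ.≤-refl
  sum-nonNegative {ℕ.suc n} v≥0 k =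
    ℚ.+-mono-≤ (v≥0 zero k) (sum-nonNegative (λ i → v≥0 (suc i)) k)

  -- Squeezing: nonnegative terms are their own absolute values, so the null sequence of `y`
  -- dominates that of `x`.
  ≤⇒≃0 : ∀ {x y} → NonNegative x → (∀ n → seq x n ℚ.≤ seq y n) →
    y ≃ fromℚ 0ℚ → x ≃ fromℚ 0ℚ
  ≤⇒≃0 {x} {y} x≥0 x≤y = null-mono λ n → subst₂ ℚ._≤_
    (sym (absolute (seq x n) (x≥0 n)))
    (sym (absolute (seq y n) (ℚ.≤-trans (x≥0 n) (x≤y n))))
    (x≤y n)
    where
    absolute : ∀ q → 0ℚ ℚ.≤ q → ∣ q - 0ℚ ∣ ≡ q
    absolute q q≥0 = trans (cong ∣_∣ (ℚ.+-identityʳ q)) (ℚ.0≤p⇒∣p∣≡p q≥0)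

  -- Both the head and the tail sum lie termwise between 0 and the whole sum, hence vanish with it;
  -- induction handles the tail.
  sum≃0⇒≃0 : ∀ {n} (v : Fin n → ℝ) → (∀ i → NonNegative (v i)) →
    sum v ≃ fromℚ 0ℚ → ∀ i → v i ≃ fromℚ 0ℚ
  sum≃0⇒≃0 v v≥0 ∑≃0 zero = ≤⇒≃0 {v zero} {sum v} (v≥0 zero)
    (λ n → subst (ℚ._≤ seq (sum v) n) (ℚ.+-identityʳ (seq (v zero) n))
      (ℚ.+-monoʳ-≤ (seq (v zero) n) (sum-nonNegative (λ i → v≥0 (suc i)) n)))
    ∑≃0
  sum≃0⇒≃0 v v≥0 ∑≃0 (suc i) = sum≃0⇒≃0 w w≥0
    (≤⇒≃0 {sum w} {sum v} (sum-nonNegative w≥0)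
      (λ n → subst (ℚ._≤ seq (sum v) n) (ℚ.+-identityˡ (seq (sum w) n))
        (ℚ.+-monoˡ-≤ (seq (sum w) n) (v≥0 zero n)))
      ∑≃0) i
    where
    w = λ i → v (suc i)
    w≥0 = λ i → v≥0 (suc i)

  square-nonNegative : ∀ x → NonNegative (x *ℝ x)
  square-nonNegative x n = subst (0ℚ ℚ.≤_) ∣q∣²≡q²
    (subst (ℚ._≤ ∣ q ∣ * ∣ q ∣) (ℚ.*-zeroʳ ∣ q ∣)
      (ℚ.*-monoˡ-≤-nonNeg ∣ q ∣ {{ℚ.∣-∣-nonNeg q}} (ℚ.0≤∣p∣ q)))
    where
    q = seq x n
    ∣q∣²≡q² : ∣ q ∣ * ∣ q ∣ ≡ q * q
    ∣q∣²≡q² with ℚ.∣p∣≡p∨∣p∣≡-p q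
    ... | inj₁ e = cong (λ z → z * z) e
    ... | inj₂ e = trans (cong (λ z → z * z) e) (solve 1 (λ q → (:- q) :* (:- q) := q :* q) refl q)

  -- The tolerance ε² for the square suffices: |xₙ| ≥ ε would force xₙ² ≥ ε², which is excluded from
  -- index `K` on.
  square≃0⇒≃0 : ∀ x → x *ℝ x ≃ fromℚ 0ℚ → x ≃ fromℚ 0ℚ
  square≃0⇒≃0 x x²≃0 ε ε>0 with x²≃0 (ε * ε) ε²>0
    where
    ε²>0 : 0ℚ < ε * ε
    ε²>0 = subst (_< ε * ε) (ℚ.*-zeroʳ ε) (ℚ.*-monoʳ-<-pos ε {{ℚ.positive ε>0}} ε>0)
  ... | K , p = K , λ n K≤n → ℚ.≰⇒> λ ε≤∣x∣ →
    ℚ.<-irrefl refl (ℚ.≤-<-trans (bound (seq x n) ε≤∣x∣) (p n K≤n))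
    where
    bound : ∀ q → ε ℚ.≤ ∣ q - 0ℚ ∣ → ε * ε ℚ.≤ ∣ q * q - 0ℚ ∣
    bound q rewrite ℚ.+-identityʳ q | ℚ.+-identityʳ (q * q) | ℚ.∣p*q∣≡∣p∣*∣q∣ q q =
      λ ε≤∣q∣ → ℚ.≤-trans
        (ℚ.*-monoˡ-≤-nonNeg ε {{ℚ.nonNegative (ℚ.<⇒≤ ε>0)}} ε≤∣q∣)
        (ℚ.*-monoʳ-≤-nonNeg ∣ q ∣ {{ℚ.∣-∣-nonNeg q}} ε≤∣q∣)

  -- This is where the ordering of the reals enters; over ℂ the claim fails, as 1 + i² = 0 shows.
  ∑∑squares≃0⇒≃0 : ∀ {m n} (X : Fin m → Fin n → ℝ) →
    sum (λ i → sum λ j → X i j *ℝ X i j) ≃ fromℚ 0ℚ → ∀ i j → X i j ≃ fromℚ 0ℚ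
  ∑∑squares≃0⇒≃0 X ∑≃0 i j = square≃0⇒≃0 (X i j)
    (sum≃0⇒≃0 _ (λ j → square-nonNegative (X i j))
      (sum≃0⇒≃0 _ (λ i → sum-nonNegative λ j → square-nonNegative (X i j)) ∑≃0 i) j)

-- Truncated polynomials

module TruncatedPolynomials {c ℓ} (K : CommutativeRing c ℓ) where

  open CommutativeRing K hiding (zero)
  open SemiringSum semiring using (sum; sum-cong-≋; sum-replicate-zero; ∑-distrib-+)
  open import Relation.Binary.Reasoning.Setoid setoid

  open CommutativeMonoidSolver +-commutativeMonoid using (solve; _⊕_; _⊜_)

  private
    interchange : ∀ a b c d → (a + b) + (c + d) ≈ (a + c) + (b + d)
    interchange = solve 4
      (λ a b c d → (a ⊕ b) ⊕ (c ⊕ d) ⊜ (a ⊕ c) ⊕ (b ⊕ d)) refl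

    swap : ∀ a b c → a + (b + c) ≈ b + (a + c)
    swap = solve 3
      (λ a b c → a ⊕ (b ⊕ c) ⊜ b ⊕ (a ⊕ c)) refl

  infixl 7 _⊛_
  -- The Cauchy product of formal power series, by recursion on the degree. Without bounded indices
  -- the ring laws follow by plain induction and are then transferred to truncations.
  _⊛_ : (ℕ → Carrier) → (ℕ → Carrier) → ℕ → Carrier
  (f ⊛ g) ℕ.zero    = f 0 * g 0
  (f ⊛ g) (ℕ.suc n) = f 0 * g (ℕ.suc n) + (f ∘ ℕ.suc ⊛ g) n

  ⊛-cong : ∀ {f f′ g g′} → (∀ n → f n ≈ f′ n) → (∀ n → g n ≈ g′ n) →
    ∀ n → (f ⊛ g) n ≈ (f′ ⊛ g′) n
  ⊛-cong f≈ g≈ ℕ.zero    = *-cong (f≈ 0) (g≈ 0)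
  ⊛-cong f≈ g≈ (ℕ.suc n) =
    +-cong (*-cong (f≈ 0) (g≈ (ℕ.suc n))) (⊛-cong (f≈ ∘ ℕ.suc) g≈ n)

  ⊛-distribˡ : ∀ f g h n → (f ⊛ (λ k → g k + h k)) n ≈ (f ⊛ g) n + (f ⊛ h) n
  ⊛-distribˡ f g h ℕ.zero    = distribˡ _ _ _
  ⊛-distribˡ f g h (ℕ.suc n) = begin
    f 0 * (g (ℕ.suc n) + h (ℕ.suc n)) + (f ∘ ℕ.suc ⊛ (λ k → g k + h k)) n
      ≈⟨ +-cong (distribˡ _ _ _) (⊛-distribˡ (f ∘ ℕ.suc) g h n) ⟩
    (f 0 * g (ℕ.suc n) + f 0 * h (ℕ.suc n)) + ((f ∘ ℕ.suc ⊛ g) n + (f ∘ ℕ.suc ⊛ h) n)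
      ≈⟨ interchange _ _ _ _ ⟩
    (f ⊛ g) (ℕ.suc n) + (f ⊛ h) (ℕ.suc n) ∎

  -- The mirror image of the defining recursion, splitting off the last term instead of the first;
  -- `⊛-comm` matches the two ends.
  ⊛-unfoldʳ : ∀ f g n → (f ⊛ g) (ℕ.suc n) ≈ f (ℕ.suc n) * g 0 + (f ⊛ g ∘ ℕ.suc) n
  ⊛-unfoldʳ f g ℕ.zero    = +-comm _ _
  ⊛-unfoldʳ f g (ℕ.suc n) =
    trans (+-congˡ (⊛-unfoldʳ (f ∘ ℕ.suc) g n)) (swap _ _ _)

  ⊛-comm : ∀ f g n → (f ⊛ g) n ≈ (g ⊛ f) n
  ⊛-comm f g ℕ.zero    = *-comm _ _
  ⊛-comm f g (ℕ.suc n) = begin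
    f 0 * g (ℕ.suc n) + (f ∘ ℕ.suc ⊛ g) n  ≈⟨ +-cong (*-comm _ _) (⊛-comm (f ∘ ℕ.suc) g n) ⟩
    g (ℕ.suc n) * f 0 + (g ⊛ f ∘ ℕ.suc) n  ≈⟨ ⊛-unfoldʳ g f n ⟨
    (g ⊛ f) (ℕ.suc n)                      ∎

  ⊛-distribʳ : ∀ f g h n → ((λ k → g k + h k) ⊛ f) n ≈ (g ⊛ f) n + (h ⊛ f) n
  ⊛-distribʳ f g h n = begin
    ((λ k → g k + h k) ⊛ f) n   ≈⟨ ⊛-comm _ f n ⟩
    (f ⊛ (λ k → g k + h k)) n   ≈⟨ ⊛-distribˡ f g h n ⟩
    (f ⊛ g) n + (f ⊛ h) n       ≈⟨ +-cong (⊛-comm f g n) (⊛-comm f h n) ⟩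
    (g ⊛ f) n + (h ⊛ f) n       ∎

  ⊛-scaleˡ : ∀ a f g n → ((λ k → a * f k) ⊛ g) n ≈ a * (f ⊛ g) n
  ⊛-scaleˡ a f g ℕ.zero    = *-assoc _ _ _
  ⊛-scaleˡ a f g (ℕ.suc n) =
    trans (+-cong (*-assoc _ _ _) (⊛-scaleˡ a (f ∘ ℕ.suc) g n)) (sym (distribˡ _ _ _))

  ⊛-assoc : ∀ f g h n → (f ⊛ g ⊛ h) n ≈ (f ⊛ (g ⊛ h)) n
  ⊛-assoc f g h ℕ.zero    = *-assoc _ _ _
  ⊛-assoc f g h (ℕ.suc n) = begin
    (f 0 * g 0) * h (ℕ.suc n) + ((λ k → f 0 * g (ℕ.suc k) + (f ∘ ℕ.suc ⊛ g) k) ⊛ h) n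
      -- By definition the shifted series of f ⊛ g is f₀ times the shift of g plus (shift of f) ⊛ g,
      -- so distributivity separates a scaled part from the inductive one.
      ≈⟨ +-cong (*-assoc _ _ _) (⊛-distribʳ h (λ k → f 0 * g (ℕ.suc k)) (f ∘ ℕ.suc ⊛ g) n) ⟩
    f 0 * (g 0 * h (ℕ.suc n)) + (((λ k → f 0 * g (ℕ.suc k)) ⊛ h) n + (f ∘ ℕ.suc ⊛ g ⊛ h) n)
      ≈⟨ +-congˡ (+-cong (⊛-scaleˡ (f 0) (g ∘ ℕ.suc) h n) (⊛-assoc (f ∘ ℕ.suc) g h n)) ⟩
    f 0 * (g 0 * h (ℕ.suc n)) + (f 0 * (g ∘ ℕ.suc ⊛ h) n + (f ∘ ℕ.suc ⊛ (g ⊛ h)) n)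
      ≈⟨ +-assoc _ _ _ ⟨
    (f 0 * (g 0 * h (ℕ.suc n)) + f 0 * (g ∘ ℕ.suc ⊛ h) n) + (f ∘ ℕ.suc ⊛ (g ⊛ h)) n
      ≈⟨ +-congʳ (distribˡ _ _ _) ⟨
    (f ⊛ (g ⊛ h)) (ℕ.suc n) ∎

  ⊛-zeroˡ : ∀ f n → ((λ _ → 0#) ⊛ f) n ≈ 0#
  ⊛-zeroˡ f ℕ.zero    = zeroˡ _
  ⊛-zeroˡ f (ℕ.suc n) = trans (+-cong (zeroˡ _) (⊛-zeroˡ f n)) (+-identityˡ 0#)

  δ₀ : ℕ → Carrier
  δ₀ ℕ.zero    = 1#
  δ₀ (ℕ.suc _) = 0#

  ⊛-identityˡ : ∀ f n → (δ₀ ⊛ f) n ≈ f n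
  ⊛-identityˡ f ℕ.zero    = *-identityˡ _
  ⊛-identityˡ f (ℕ.suc n) =
    trans (+-cong (*-identityˡ _) (⊛-zeroˡ f n)) (+-identityʳ _)

  -- Transfer from power series to truncated polynomials

  sum≈⊛ : ∀ f g n →
    sum {ℕ.suc n} (λ i → f (toℕ i) * g (toℕ (opposite i))) ≈ (f ⊛ g) n
  sum≈⊛ f g ℕ.zero    = +-identityʳ _
  sum≈⊛ f g (ℕ.suc n) = +-cong
    -- `opposite zero` is the largest index, and `opposite (suc i)` is `inject₁ (opposite i)`; both
    -- therefore have the values required by the recursion of `⊛`.
    (*-congˡ (reflexive (≡.cong g (Fin.toℕ-fromℕ (ℕ.suc n)))))
    (trans
      (sum-cong-≋ {ℕ.suc n} λ i →
        *-congˡ {f (ℕ.suc (toℕ i))} (reflexive (≡.cong g (Fin.toℕ-inject₁ (opposite i)))))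
      (sum≈⊛ (f ∘ ℕ.suc) g n))

  extend : ∀ {D} → Vector Carrier D → ℕ → Carrier
  extend {ℕ.zero}  p n         = 0#
  extend {ℕ.suc D} p ℕ.zero    = p zero
  extend {ℕ.suc D} p (ℕ.suc n) = extend (p ∘ suc) n

  extend-toℕ : ∀ {D} (p : Vector Carrier D) d → extend p (toℕ d) ≡ p d
  extend-toℕ p zero    = ≡.refl
  extend-toℕ p (suc d) = extend-toℕ (p ∘ suc) d

  module _ {D : ℕ} where
    private
      P = rawRing [t]/t^ D
      module P = RawRing P

    *ₚ-cong : ∀ {p p′ q q′} → p P.≈ p′ → q P.≈ q′ → p P.* q P.≈ p′ P.* q′
    *ₚ-cong p≈ q≈ d = sum-cong-≋ {ℕ.suc (toℕ d)} λ i →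
      *-cong (p≈ (inject≤ i (Fin.toℕ<n d))) (q≈ (inject≤ (opposite i) (Fin.toℕ<n d)))

    -- Coefficient d < D of a Cauchy product involves only indices at most d, so truncating before
    -- or after multiplication gives the same result.
    truncate-* : ∀ f g → (f ∘ toℕ) P.* (g ∘ toℕ) P.≈ (f ⊛ g) ∘ toℕ
    truncate-* f g d = trans
      (sum-cong-≋ {ℕ.suc (toℕ d)} λ i → *-cong
        (reflexive (≡.cong f (Fin.toℕ-inject≤ i (Fin.toℕ<n d))))
        (reflexive (≡.cong g (Fin.toℕ-inject≤ (opposite i) (Fin.toℕ<n d)))))
      (sum≈⊛ f g (toℕ d))

    *ₚ≈⊛ : ∀ p q → p P.* q P.≈ (extend p ⊛ extend q) ∘ toℕ
    *ₚ≈⊛ p q d = trans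
      (*ₚ-cong (λ i → reflexive (≡.sym (extend-toℕ p i))) (λ i → reflexive (≡.sym (extend-toℕ q i))) d)
      (truncate-* (extend p) (extend q) d)

    ≈truncate : ∀ p → p P.≈ extend p ∘ toℕ
    ≈truncate p d = reflexive (≡.sym (extend-toℕ p d))

    *ₚ-comm : ∀ p q → p P.* q P.≈ q P.* p
    *ₚ-comm p q d = begin
      (p P.* q) d                      ≈⟨ *ₚ≈⊛ p q d ⟩
      (extend p ⊛ extend q) (toℕ d)    ≈⟨ ⊛-comm (extend p) (extend q) (toℕ d) ⟩
      (extend q ⊛ extend p) (toℕ d)    ≈⟨ *ₚ≈⊛ q p d ⟨
      (q P.* p) d                      ∎

    -- The inner product is kept as a truncation of the full `⊛` product, including its terms of
    -- degree at least D, rather than padded with zeros again. `truncate-*` then reduces the claim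
    -- to `⊛-assoc`.
    *ₚ-assoc : ∀ p q r → (p P.* q) P.* r P.≈ p P.* (q P.* r)
    *ₚ-assoc p q r d = begin
      ((p P.* q) P.* r) d
        ≈⟨ *ₚ-cong (*ₚ≈⊛ p q) (≈truncate r) d ⟩
      (((extend p ⊛ extend q) ∘ toℕ) P.* (extend r ∘ toℕ)) d
        ≈⟨ truncate-* (extend p ⊛ extend q) (extend r) d ⟩
      (extend p ⊛ extend q ⊛ extend r) (toℕ d)
        ≈⟨ ⊛-assoc (extend p) (extend q) (extend r) (toℕ d) ⟩
      (extend p ⊛ (extend q ⊛ extend r)) (toℕ d)
        ≈⟨ truncate-* (extend p) (extend q ⊛ extend r) d ⟨
      ((extend p ∘ toℕ) P.* ((extend q ⊛ extend r) ∘ toℕ)) d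
        ≈⟨ *ₚ-cong (≈truncate p) (*ₚ≈⊛ q r) d ⟨
      (p P.* (q P.* r)) d ∎

    1ₚ≈δ₀ : P.1# P.≈ δ₀ ∘ toℕ
    1ₚ≈δ₀ zero    = refl
    1ₚ≈δ₀ (suc d) = refl

    *ₚ-identityˡ : ∀ p → P.1# P.* p P.≈ p
    *ₚ-identityˡ p d = begin
      (P.1# P.* p) d                     ≈⟨ *ₚ-cong 1ₚ≈δ₀ (≈truncate p) d ⟩
      ((δ₀ ∘ toℕ) P.* (extend p ∘ toℕ)) d ≈⟨ truncate-* δ₀ (extend p) d ⟩
      (δ₀ ⊛ extend p) (toℕ d)            ≈⟨ ⊛-identityˡ (extend p) (toℕ d) ⟩
      extend p (toℕ d)                   ≈⟨ ≈truncate p d ⟨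
      p d                                ∎

    *ₚ-distribˡ : ∀ p q r → p P.* (q P.+ r) P.≈ p P.* q P.+ p P.* r
    *ₚ-distribˡ p q r d = trans
      (sum-cong-≋ {ℕ.suc (toℕ d)} λ i → distribˡ (p (l i)) (q (r′ i)) (r (r′ i)))
      (∑-distrib-+ {ℕ.suc (toℕ d)} (λ i → p (l i) * q (r′ i)) (λ i → p (l i) * r (r′ i)))
      where
      l r′ : Fin (ℕ.suc (toℕ d)) → Fin D
      l i  = inject≤ i (Fin.toℕ<n d)
      r′ i = inject≤ (opposite i) (Fin.toℕ<n d)

    [t]/t^-isCommutativeRing : IsCommutativeRing P._≈_ P._+_ P._*_ P.-_ P.0# P.1#
    [t]/t^-isCommutativeRing = record
      { isRing = record
        { +-isAbelianGroup = isAbelianGroup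
        ; *-cong     = λ {p} {p′} {q} {q′} → *ₚ-cong {p} {p′} {q} {q′}
        ; *-assoc    = *ₚ-assoc
        ; *-identity = C.comm∧idˡ⇒id {P._*_} *ₚ-comm {P.1#} *ₚ-identityˡ
        ; distrib    = C.comm∧distrˡ⇒distr {P._*_} {P._+_}
            (λ {p} {p′} {q} {q′} → IsAbelianGroup.∙-cong isAbelianGroup {p} {p′} {q} {q′})
            *ₚ-comm *ₚ-distribˡ
        }
      ; *-comm = *ₚ-comm
      }
      where
      isAbelianGroup : IsAbelianGroup P._≈_ P._+_ P.0# P.-_
      isAbelianGroup = Pointwise.isAbelianGroup (Fin D) +-isAbelianGroup
      setoidₚ : Setoid c ℓ
      setoidₚ = record { isEquivalence = IsAbelianGroup.isEquivalence isAbelianGroup }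
      module C = Consequences setoidₚ

  [t]/t^-commutativeRing : ℕ → CommutativeRing c ℓ
  [t]/t^-commutativeRing D = record { isCommutativeRing = [t]/t^-isCommutativeRing {D} }

  -- Matrices with truncated polynomial entries

  module _ {D : ℕ} where
    private
      module P = RawRing (rawRing [t]/t^ D)
    open RawMonoidDefinitions P.+-rawMonoid renaming (sum to sumₚ)
    open Matrices (rawRing [t]/t^ D) using (Matrix; _≈ᴹ_; _*ᴹ_; 0ᴹ)

    [t]/t^-2-torsion-free : (∀ x → x + x ≈ 0# → x ≈ 0#) → ∀ p → p P.+ p P.≈ P.0# → p P.≈ P.0#
    [t]/t^-2-torsion-free torsion-free p p+p≈0 d = torsion-free (p d) (p+p≈0 d)

    sum-coefficient : ∀ {n} (v : Fin n → P.Carrier) d → sumₚ v d ≈ sum (λ i → v i d)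
    sum-coefficient {ℕ.zero}  v d = refl
    sum-coefficient {ℕ.suc n} v d = +-congˡ (sum-coefficient (v ∘ suc) d)

    -- In degree d, each term of X² = X has a factor of degree less than d or
    -- a constant factor.
    idempotent-vanishes : ∀ {n} (X : Matrix n n) → X *ᴹ X ≈ᴹ X →
      (∀ i j d → toℕ d ≡ 0 → X i j d ≈ 0#) → X ≈ᴹ 0ᴹ
    idempotent-vanishes {n} X X²≈X constant≈0 i j d = go (ℕ.suc (toℕ d)) d ℕ.≤-refl i j
      where
      go : ∀ k (d : Fin D) → toℕ d ℕ.< k → ∀ i j → X i j d ≈ 0#
      go (ℕ.suc k) d d<1+k i j = begin
        X i j d                           ≈⟨ X²≈X i j d ⟨
        (X *ᴹ X) i j d                    ≈⟨ sum-coefficient (λ l → X i l P.* X l j) d ⟩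
        sum (λ l → (X i l P.* X l j) d)   ≈⟨ sum-zero (λ l → sum-zero (term≈0 l)) ⟩
        0#                                ∎
        where
        sum-zero : ∀ {m} {v : Fin m → Carrier} → (∀ a → v a ≈ 0#) → sum v ≈ 0#
        sum-zero {m} v≈0 = trans (sum-cong-≋ v≈0) (sum-replicate-zero m)

        term≈0 : ∀ l (a : Fin (ℕ.suc (toℕ d))) →
          X i l (inject≤ a (Fin.toℕ<n d)) * X l j (inject≤ (opposite a) (Fin.toℕ<n d)) ≈ 0#
        term≈0 l a with ℕ.<-≤-connex (toℕ a) (toℕ d)
        ... | inj₁ a<d = trans
          (*-congʳ (go k (inject≤ a (Fin.toℕ<n d))
            (ℕ.≤-<-trans (ℕ.≤-reflexive (Fin.toℕ-inject≤ a (Fin.toℕ<n d)))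
              (ℕ.<-≤-trans a<d (ℕ.s≤s⁻¹ d<1+k))) i l))
          (zeroˡ _)
        ... | inj₂ d≤a = trans
          (*-congˡ (constant≈0 l j _
            (≡.trans (Fin.toℕ-inject≤ (opposite a) (Fin.toℕ<n d))
              (≡.trans (Fin.opposite-prop a) (ℕ.m≤n⇒m∸n≡0 d≤a)))))
          (zeroʳ _)

  module _ {D : ℕ} where
    open Matrices (rawRing [t]/t^ ℕ.suc D) using (Matrix; _*ᴹ_; _ᵀ; tr)
    private
      module P = RawRing (rawRing [t]/t^ ℕ.suc D)

    norm-constant : ∀ {m n} (X : Matrix m n) →
      tr (X ᵀ *ᴹ X) zero ≈ sum (λ j → sum λ i → X i j zero * X i j zero)
    norm-constant {m} {n} X = begin
      tr (X ᵀ *ᴹ X) zero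
        ≈⟨ sum-coefficient {ℕ.suc D} {n} (λ j → (X ᵀ *ᴹ X) j j) zero ⟩
      sum (λ j → (X ᵀ *ᴹ X) j j zero)
        ≈⟨ sum-cong-≋ {n} (λ j → sum-coefficient {ℕ.suc D} {m} (λ i → X i j P.* X i j) zero) ⟩
      -- In degree 0 the convolution has a single term; `+ 0#` is the empty rest of its sum.
      sum (λ j → sum λ i → X i j zero * X i j zero + 0#)
        ≈⟨ sum-cong-≋ {n} (λ j → sum-cong-≋ {m} λ i → +-identityʳ (X i j zero * X i j zero)) ⟩
      sum (λ j → sum λ i → X i j zero * X i j zero) ∎

-- Matrices over a commutative ring

module MatrixAlgebra {c ℓ} (𝓡 : CommutativeRing c ℓ) where

  open CommutativeRing 𝓡 hiding (zero)
  open Matrices rawRing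
    using (Matrix; _≈ᴹ_; 0ᴹ; I; _+ᴹ_; -ᴹ_; _-ᴹ_; _*ᴹ_; _∘ᴹ_; _ᵀ; tr; Pᴸ)
  open RingProperties ring
    using ( -‿distribˡ-*; -‿distribʳ-*; -‿+-comm; -0#≈0#; -‿involutive
          ; +-inverseˡ-unique)
  open SemiringSum semiring
    using ( sum; sum-cong-≋; sum-replicate-zero; sum-remove; ∑-distrib-+; ∑-comm
          ; *-distribˡ-sum; *-distribʳ-sum)
  open import Relation.Binary.Reasoning.Setoid setoid
  open CommutativeMonoidSolver +-commutativeMonoid using (solve; _⊕_; _⊜_)

  -- Finite sums

  sum-zero : ∀ {n} {v : Fin n → Carrier} → (∀ i → v i ≈ 0#) → sum v ≈ 0#
  sum-zero {n} v≈0 = trans (sum-cong-≋ v≈0) (sum-replicate-zero n)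

  sum-single : ∀ {n} (v : Fin n → Carrier) k → (∀ l → l ≢ k → v l ≈ 0#) → sum v ≈ v k
  sum-single {ℕ.suc n} v k v≈0 = begin
    sum v                                ≈⟨ sum-remove {i = k} v ⟩
    v k + sum (λ l → v (Fin.punchIn k l)) ≈⟨ +-congˡ (sum-zero λ l → v≈0 _ (Fin.punchInᵢ≢i k l)) ⟩
    v k + 0#                             ≈⟨ +-identityʳ (v k) ⟩
    v k                                  ∎

  sum-neg : ∀ {n} (v : Fin n → Carrier) → sum (λ i → - v i) ≈ - sum v
  sum-neg {ℕ.zero}  v = sym -0#≈0#
  sum-neg {ℕ.suc n} v = trans (+-congˡ (sum-neg (v ∘ suc))) (-‿+-comm _ _)

  -- Matrix arithmetic

  +ᴹ-abelianGroup : ℕ → ℕ → AbelianGroup c ℓ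
  +ᴹ-abelianGroup m n = record
    { isAbelianGroup = Pointwise.isAbelianGroup (Fin m)
        (Pointwise.isAbelianGroup (Fin n) +-isAbelianGroup) }

  module _ {m n : ℕ} where
    open AbelianGroup (+ᴹ-abelianGroup m n) public using ()
      renaming (refl to ≈ᴹ-refl; sym to ≈ᴹ-sym; trans to ≈ᴹ-trans)

  +ᴹ-cong : ∀ {m n} {X X′ Y Y′ : Matrix m n} → X ≈ᴹ X′ → Y ≈ᴹ Y′ → X +ᴹ Y ≈ᴹ X′ +ᴹ Y′
  +ᴹ-cong p q i j = +-cong (p i j) (q i j)

  *ᴹ-cong : ∀ {m k n} {X X′ : Matrix m k} {Y Y′ : Matrix k n} →
    X ≈ᴹ X′ → Y ≈ᴹ Y′ → X *ᴹ Y ≈ᴹ X′ *ᴹ Y′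
  *ᴹ-cong p q i j = sum-cong-≋ λ l → *-cong (p i l) (q l j)

  *ᴹ-congˡ : ∀ {m k n} (X : Matrix m k) {Y Y′ : Matrix k n} → Y ≈ᴹ Y′ → X *ᴹ Y ≈ᴹ X *ᴹ Y′
  *ᴹ-congˡ X q = *ᴹ-cong {X = X} (λ _ _ → refl) q

  *ᴹ-congʳ : ∀ {m k n} {X X′ : Matrix m k} (Y : Matrix k n) → X ≈ᴹ X′ → X *ᴹ Y ≈ᴹ X′ *ᴹ Y
  *ᴹ-congʳ Y p = *ᴹ-cong {Y = Y} p (λ _ _ → refl)

  *ᴹ-assoc : ∀ {m k l n} (X : Matrix m k) (Y : Matrix k l) (Z : Matrix l n) →
    X *ᴹ Y *ᴹ Z ≈ᴹ X *ᴹ (Y *ᴹ Z)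
  *ᴹ-assoc {k = k} {l} X Y Z i j = begin
    sum (λ b → sum (λ a → X i a * Y a b) * Z b j)
      ≈⟨ sum-cong-≋ {l} (λ b → *-distribʳ-sum {k} (Z b j) (λ a → X i a * Y a b)) ⟩
    sum (λ b → sum λ a → X i a * Y a b * Z b j)
      ≈⟨ ∑-comm {l} {k} (λ b a → X i a * Y a b * Z b j) ⟩
    sum (λ a → sum λ b → X i a * Y a b * Z b j)
      ≈⟨ sum-cong-≋ {k} (λ a → sum-cong-≋ {l} λ b → *-assoc (X i a) (Y a b) (Z b j)) ⟩
    sum (λ a → sum λ b → X i a * (Y a b * Z b j))
      ≈⟨ sum-cong-≋ {k} (λ a → *-distribˡ-sum {l} (X i a) (λ b → Y a b * Z b j)) ⟨
    sum (λ a → X i a * sum λ b → Y a b * Z b j) ∎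

  *ᴹ-distribˡ-+ᴹ : ∀ {m k n} (X : Matrix m k) (Y Z : Matrix k n) →
    X *ᴹ (Y +ᴹ Z) ≈ᴹ X *ᴹ Y +ᴹ X *ᴹ Z
  *ᴹ-distribˡ-+ᴹ {k = k} X Y Z i j = trans
    (sum-cong-≋ {k} λ l → distribˡ (X i l) (Y l j) (Z l j))
    (∑-distrib-+ {k} (λ l → X i l * Y l j) (λ l → X i l * Z l j))

  *ᴹ-distribʳ-+ᴹ : ∀ {m k n} (X : Matrix k n) (Y Z : Matrix m k) →
    (Y +ᴹ Z) *ᴹ X ≈ᴹ Y *ᴹ X +ᴹ Z *ᴹ X
  *ᴹ-distribʳ-+ᴹ {k = k} X Y Z i j = trans
    (sum-cong-≋ {k} λ l → distribʳ (X l j) (Y i l) (Z i l))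
    (∑-distrib-+ {k} (λ l → Y i l * X l j) (λ l → Z i l * X l j))

  -ᴹ‿distribˡ-*ᴹ : ∀ {m k n} (X : Matrix m k) (Y : Matrix k n) → (-ᴹ X) *ᴹ Y ≈ᴹ -ᴹ (X *ᴹ Y)
  -ᴹ‿distribˡ-*ᴹ {k = k} X Y i j = trans
    (sum-cong-≋ {k} λ l → sym (-‿distribˡ-* (X i l) (Y l j)))
    (sum-neg {k} λ l → X i l * Y l j)

  -ᴹ‿distribʳ-*ᴹ : ∀ {m k n} (X : Matrix m k) (Y : Matrix k n) → X *ᴹ (-ᴹ Y) ≈ᴹ -ᴹ (X *ᴹ Y)
  -ᴹ‿distribʳ-*ᴹ {k = k} X Y i j = trans
    (sum-cong-≋ {k} λ l → sym (-‿distribʳ-* (X i l) (Y l j)))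
    (sum-neg {k} λ l → X i l * Y l j)

  *ᴹ-zeroˡ : ∀ {m k n} (Y : Matrix k n) → 0ᴹ {m} *ᴹ Y ≈ᴹ 0ᴹ
  *ᴹ-zeroˡ Y i j = sum-zero λ l → zeroˡ (Y l j)

  *ᴹ-zeroʳ : ∀ {m k n} (X : Matrix m k) → X *ᴹ 0ᴹ {k} {n} ≈ᴹ 0ᴹ
  *ᴹ-zeroʳ X i j = sum-zero λ l → zeroʳ (X i l)

  ᵀ-*ᴹ : ∀ {m k n} (X : Matrix m k) (Y : Matrix k n) → (X *ᴹ Y) ᵀ ≈ᴹ Y ᵀ *ᴹ X ᵀ
  ᵀ-*ᴹ X Y i j = sum-cong-≋ λ l → *-comm (X j l) (Y l i)

  I-diagonal : ∀ {n} (i : Fin n) → I i i ≈ 1#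
  I-diagonal i rewrite dec-true (i Fin.≟ i) ≡.refl = refl

  I-off-diagonal : ∀ {n} {i j : Fin n} → i ≢ j → I i j ≈ 0#
  I-off-diagonal {i = i} {j} i≢j rewrite dec-false (i Fin.≟ j) i≢j = refl

  I-symmetric : ∀ {n} → I {n} ᵀ ≈ᴹ I
  I-symmetric i j with i Fin.≟ j
  ... | yes ≡.refl = I-diagonal i
  ... | no  i≢j    = I-off-diagonal (i≢j ∘ ≡.sym)

  *ᴹ-identityˡ : ∀ {m n} (X : Matrix m n) → I *ᴹ X ≈ᴹ X
  *ᴹ-identityˡ X i j = begin
    sum (λ l → I i l * X l j) ≈⟨ sum-single _ i (λ l l≢i →
                                   trans (*-congʳ (I-off-diagonal (l≢i ∘ ≡.sym))) (zeroˡ _)) ⟩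
    I i i * X i j             ≈⟨ *-congʳ (I-diagonal i) ⟩
    1# * X i j                ≈⟨ *-identityˡ _ ⟩
    X i j                     ∎

  *ᴹ-identityʳ : ∀ {m n} (X : Matrix m n) → X *ᴹ I ≈ᴹ X
  *ᴹ-identityʳ X i j = begin
    sum (λ l → X i l * I l j) ≈⟨ sum-single _ j (λ l l≢j →
                                   trans (*-congˡ (I-off-diagonal l≢j)) (zeroʳ _)) ⟩
    X i j * I j j             ≈⟨ *-congˡ (I-diagonal j) ⟩
    X i j * 1#                ≈⟨ *-identityʳ _ ⟩
    X i j                     ∎

  tr-cong : ∀ {n} {X Y : Matrix n n} → X ≈ᴹ Y → tr X ≈ tr Y
  tr-cong X≈Y = sum-cong-≋ λ i → X≈Y i i

  tr-comm : ∀ {m n} (X : Matrix m n) (Y : Matrix n m) → tr (X *ᴹ Y) ≈ tr (Y *ᴹ X)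
  tr-comm {m} {n} X Y = trans
    (∑-comm {m} {n} λ i l → X i l * Y l i)
    (sum-cong-≋ {n} λ l → sum-cong-≋ {m} λ i → *-comm (X i l) (Y l i))

  -- The Frobenius inner product

  ⟨_,_⟩ : ∀ {m n} → Matrix m n → Matrix m n → Carrier
  ⟨ X , Y ⟩ = tr (X ᵀ *ᴹ Y)

  ⟨⟩-cong : ∀ {m n} {X X′ Y Y′ : Matrix m n} → X ≈ᴹ X′ → Y ≈ᴹ Y′ → ⟨ X , Y ⟩ ≈ ⟨ X′ , Y′ ⟩
  ⟨⟩-cong p q = tr-cong (*ᴹ-cong (flip p) q)

  ⟨⟩-congˡ : ∀ {m n} (X : Matrix m n) {Y Y′ : Matrix m n} → Y ≈ᴹ Y′ → ⟨ X , Y ⟩ ≈ ⟨ X , Y′ ⟩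
  ⟨⟩-congˡ X = ⟨⟩-cong {X = X} (λ _ _ → refl)

  ⟨⟩-congʳ : ∀ {m n} {X X′ : Matrix m n} (Y : Matrix m n) → X ≈ᴹ X′ → ⟨ X , Y ⟩ ≈ ⟨ X′ , Y ⟩
  ⟨⟩-congʳ Y p = ⟨⟩-cong {Y = Y} p (λ _ _ → refl)

  ⟨⟩-+ˡ : ∀ {m n} (X Y Z : Matrix m n) → ⟨ X +ᴹ Y , Z ⟩ ≈ ⟨ X , Z ⟩ + ⟨ Y , Z ⟩
  ⟨⟩-+ˡ {m} {n} X Y Z = trans
    (tr-cong (*ᴹ-distribʳ-+ᴹ Z (X ᵀ) (Y ᵀ)))
    (∑-distrib-+ {n} (λ i → (X ᵀ *ᴹ Z) i i) (λ i → (Y ᵀ *ᴹ Z) i i))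

  ⟨⟩-+ʳ : ∀ {m n} (X Y Z : Matrix m n) → ⟨ X , Y +ᴹ Z ⟩ ≈ ⟨ X , Y ⟩ + ⟨ X , Z ⟩
  ⟨⟩-+ʳ {m} {n} X Y Z = trans
    (tr-cong (*ᴹ-distribˡ-+ᴹ (X ᵀ) Y Z))
    (∑-distrib-+ {n} (λ i → (X ᵀ *ᴹ Y) i i) (λ i → (X ᵀ *ᴹ Z) i i))

  ⟨⟩-negˡ : ∀ {m n} (X Y : Matrix m n) → ⟨ -ᴹ X , Y ⟩ ≈ - ⟨ X , Y ⟩
  ⟨⟩-negˡ {m} {n} X Y = trans
    (tr-cong (-ᴹ‿distribˡ-*ᴹ (X ᵀ) Y))
    (sum-neg {n} λ i → (X ᵀ *ᴹ Y) i i)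

  ⟨⟩-negʳ : ∀ {m n} (X Y : Matrix m n) → ⟨ X , -ᴹ Y ⟩ ≈ - ⟨ X , Y ⟩
  ⟨⟩-negʳ {m} {n} X Y = trans
    (tr-cong (-ᴹ‿distribʳ-*ᴹ (X ᵀ) Y))
    (sum-neg {n} λ i → (X ᵀ *ᴹ Y) i i)

  ⟨⟩-zeroˡ : ∀ {m n} {X : Matrix m n} (Y : Matrix m n) → X ≈ᴹ 0ᴹ → ⟨ X , Y ⟩ ≈ 0#
  ⟨⟩-zeroˡ Y X≈0 = trans (⟨⟩-congʳ Y X≈0) (sum-zero λ i → *ᴹ-zeroˡ Y i i)

  ⟨⟩-zeroʳ : ∀ {m n} (X : Matrix m n) {Y : Matrix m n} → Y ≈ᴹ 0ᴹ → ⟨ X , Y ⟩ ≈ 0#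
  ⟨⟩-zeroʳ X Y≈0 = trans (⟨⟩-congˡ X Y≈0) (sum-zero λ i → *ᴹ-zeroʳ (X ᵀ) i i)

  ⟨⟩-adjointˡ : ∀ {m k n} (X : Matrix m k) (Y : Matrix k n) (Z : Matrix m n) →
    ⟨ X *ᴹ Y , Z ⟩ ≈ ⟨ Y , X ᵀ *ᴹ Z ⟩
  ⟨⟩-adjointˡ X Y Z = tr-cong (≈ᴹ-trans (*ᴹ-congʳ Z (ᵀ-*ᴹ X Y)) (*ᴹ-assoc (Y ᵀ) (X ᵀ) Z))

  -- Cyclicity of the trace carries the transposed right factor around to the other argument.
  ⟨⟩-adjointʳ : ∀ {m k n} (X : Matrix m k) (Y : Matrix k n) (Z : Matrix m n) →
    ⟨ X *ᴹ Y , Z ⟩ ≈ ⟨ X , Z *ᴹ Y ᵀ ⟩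
  ⟨⟩-adjointʳ X Y Z = begin
    tr ((X *ᴹ Y) ᵀ *ᴹ Z)    ≈⟨ ⟨⟩-adjointˡ X Y Z ⟩
    tr (Y ᵀ *ᴹ (X ᵀ *ᴹ Z))  ≈⟨ tr-comm (Y ᵀ) (X ᵀ *ᴹ Z) ⟩
    tr (X ᵀ *ᴹ Z *ᴹ Y ᵀ)    ≈⟨ tr-cong (*ᴹ-assoc (X ᵀ) Z (Y ᵀ)) ⟩
    tr (X ᵀ *ᴹ (Z *ᴹ Y ᵀ))  ∎

  ⟨⟩-ᵀ : ∀ {m n} (X : Matrix m n) (Y : Matrix n m) → ⟨ X ᵀ , Y ⟩ ≈ ⟨ X , Y ᵀ ⟩
  ⟨⟩-ᵀ {m} {n} X Y = ∑-comm {m} {n} λ i l → X i l * Y l i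

  -- Entrywise multiplication is diagonal in the basis of matrix units, hence self-adjoint; this
  -- lets the mask change sides.
  ⟨⟩-∘ : ∀ {m n} (P X Y : Matrix m n) → ⟨ P ∘ᴹ X , Y ⟩ ≈ ⟨ X , P ∘ᴹ Y ⟩
  ⟨⟩-∘ {m} {n} P X Y = sum-cong-≋ {n} λ j → sum-cong-≋ {m} λ i →
    trans (*-congʳ (*-comm (P i j) (X i j))) (*-assoc (X i j) (P i j) (Y i j))

  -- Triangular matrices

  Pᴸ-below : ∀ {n} {i j : Fin n} → j Fin.< i → Pᴸ i j ≈ 1#
  Pᴸ-below {i = i} {j} j<i rewrite dec-true (j Fin.<? i) j<i = refl

  Pᴸ-above : ∀ {n} {i j : Fin n} → i Fin.≤ j → Pᴸ i j ≈ 0#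
  Pᴸ-above {i = i} {j} i≤j rewrite dec-false (j Fin.<? i) (ℕ.≤⇒≯ i≤j) = refl

  UpperTriangular : ∀ {n} → Matrix n n → Set ℓ
  UpperTriangular X = ∀ {i j} → j Fin.< i → X i j ≈ 0#

  upper⇒Pᴸ∘≈0 : ∀ {n} {X : Matrix n n} → UpperTriangular X → Pᴸ ∘ᴹ X ≈ᴹ 0ᴹ
  upper⇒Pᴸ∘≈0 {X = X} upper i j with ℕ.<-≤-connex (toℕ j) (toℕ i)
  ... | inj₁ j<i = trans (*-congˡ (upper j<i)) (zeroʳ _)
  ... | inj₂ i≤j = trans (*-congʳ (Pᴸ-above i≤j)) (zeroˡ _)

  Pᴸ∘≈0⇒upper : ∀ {n} {X : Matrix n n} → Pᴸ ∘ᴹ X ≈ᴹ 0ᴹ → UpperTriangular X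
  Pᴸ∘≈0⇒upper {X = X} P∘X≈0 {i} {j} j<i = begin
    X i j             ≈⟨ *-identityˡ _ ⟨
    1# * X i j        ≈⟨ *-congʳ (Pᴸ-below j<i) ⟨
    Pᴸ i j * X i j    ≈⟨ P∘X≈0 i j ⟩
    0#                ∎

  -- In each term, `l < i` kills the left factor, while `i ≤ l` gives `j < l` and kills the right
  -- one.
  upper-*ᴹ : ∀ {n} {X Y : Matrix n n} →
    UpperTriangular X → UpperTriangular Y → UpperTriangular (X *ᴹ Y)
  upper-*ᴹ {X = X} {Y} upperX upperY {i} {j} j<i = sum-zero term≈0
    where
    term≈0 : ∀ l → X i l * Y l j ≈ 0#
    term≈0 l with ℕ.<-≤-connex (toℕ l) (toℕ i)
    ... | inj₁ l<i = trans (*-congʳ (upperX l<i)) (zeroˡ _)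
    ... | inj₂ i≤l = trans (*-congˡ (upperY (ℕ.<-≤-trans j<i i≤l))) (zeroʳ _)

  -- By induction on the column j, only the j-th term of (S R)ᵢⱼ = Σₗ Sᵢₗ Rₗⱼ
  -- survives for i ≥ j; hence Sⱼⱼ Rⱼⱼ = 1, and Sᵢⱼ Rⱼⱼ = 0 for i > j.
  leftInverse-upper : ∀ {n} {R S : Matrix n n} →
    UpperTriangular R → S *ᴹ R ≈ᴹ I → UpperTriangular S
  leftInverse-upper {n} {R} {S} upperR SR≈I {i} {j} j<i = go (ℕ.suc (toℕ j)) j (ℕ.n<1+n _) i j<i
    where
    go : ∀ k (j : Fin n) → toℕ j ℕ.< k → ∀ i → j Fin.< i → S i j ≈ 0#
    go (ℕ.suc k) j j<1+k i j<i = begin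
      S i j                   ≈⟨ *-identityʳ _ ⟨
      S i j * 1#              ≈⟨ *-congˡ (trans (sym (I-diagonal j)) (sym (SR≈I j j))) ⟩
      S i j * (S *ᴹ R) j j    ≈⟨ *-congˡ (single j ℕ.≤-refl) ⟩
      S i j * (S j j * R j j) ≈⟨ *-congˡ (*-comm (S j j) (R j j)) ⟩
      S i j * (R j j * S j j) ≈⟨ *-assoc _ _ _ ⟨
      S i j * R j j * S j j   ≈⟨ *-congʳ (single i (ℕ.<⇒≤ j<i)) ⟨
      (S *ᴹ R) i j * S j j    ≈⟨ *-congʳ (SR≈I i j) ⟩
      I i j * S j j           ≈⟨ *-congʳ (I-off-diagonal λ i≡j → Fin.<-irrefl (≡.sym i≡j) j<i) ⟩
      0# * S j j              ≈⟨ zeroˡ _ ⟩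
      0#                      ∎
      where
      single : ∀ i → j Fin.≤ i → (S *ᴹ R) i j ≈ S i j * R j j
      single i j≤i = sum-single (λ l → S i l * R l j) j off
        where
        off : ∀ l → l ≢ j → S i l * R l j ≈ 0#
        off l l≢j with Fin.<-cmp l j
        ... | tri< l<j _ _ = trans
          (*-congʳ (go k l (ℕ.<-≤-trans l<j (ℕ.s≤s⁻¹ j<1+k)) i (ℕ.<-≤-trans l<j j≤i))) (zeroˡ _)
        ... | tri≈ _ l≡j _ with () ← l≢j l≡j
        ... | tri> _ _ j<l = trans (*-congˡ (upperR j<l)) (zeroʳ _)

  -- Skew-symmetric matrices

  module _ (2-torsion-free : ∀ x → x + x ≈ 0# → x ≈ 0#) where

    -- A skew matrix is determined by its strictly lower part. Above the diagonal only the
    -- transposed part contributes, and Ωⱼᵢ = -Ωᵢⱼ; on the diagonal the two parts cancel, and 2Ωᵢᵢ =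
    -- 0 gives Ωᵢᵢ = 0.
    skew-mask : ∀ {n} {Ω : Matrix n n} → Ω ᵀ +ᴹ Ω ≈ᴹ 0ᴹ →
      (Pᴸ ∘ᴹ Ω) ᵀ -ᴹ Pᴸ ∘ᴹ Ω ≈ᴹ -ᴹ Ω
    skew-mask {Ω = Ω} skew i j with Fin.<-cmp i j
    ... | tri< i<j _ _ = begin
      Pᴸ j i * Ω j i + - (Pᴸ i j * Ω i j)
        ≈⟨ +-cong (*-congʳ (Pᴸ-below i<j)) (-‿cong (*-congʳ (Pᴸ-above (ℕ.<⇒≤ i<j)))) ⟩
      1# * Ω j i + - (0# * Ω i j)
        ≈⟨ +-cong (*-identityˡ _) (trans (-‿cong (zeroˡ _)) -0#≈0#) ⟩
      Ω j i + 0#     ≈⟨ +-identityʳ _ ⟩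
      Ω j i          ≈⟨ +-inverseˡ-unique (Ω j i) (Ω i j) (skew i j) ⟩
      - Ω i j        ∎
    ... | tri≈ _ ≡.refl _ = begin
      Pᴸ i i * Ω i i + - (Pᴸ i i * Ω i i)  ≈⟨ -‿inverseʳ _ ⟩
      0#                                   ≈⟨ -0#≈0# ⟨
      - 0#                                 ≈⟨ -‿cong (2-torsion-free (Ω i i) (skew i i)) ⟨
      - Ω i i                              ∎
    ... | tri> _ _ j<i = begin
      Pᴸ j i * Ω j i + - (Pᴸ i j * Ω i j)
        ≈⟨ +-cong (*-congʳ (Pᴸ-above (ℕ.<⇒≤ j<i))) (-‿cong (*-congʳ (Pᴸ-below j<i))) ⟩
      0# * Ω j i + - (1# * Ω i j)
        ≈⟨ +-cong (zeroˡ _) (-‿cong (*-identityˡ _)) ⟩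
      0# + - Ω i j   ≈⟨ +-identityˡ _ ⟩
      - Ω i j        ∎

    -- Moving the mask and then the transpose onto the second argument leaves `V` paired with
    -- `G ᵀ -ᴹ G`, which `skew-mask` evaluates.
    ⟨⟩-skew-mask : ∀ {n} (V Ω : Matrix n n) → Ω ᵀ +ᴹ Ω ≈ᴹ 0ᴹ →
      ⟨ Pᴸ ∘ᴹ (V ᵀ -ᴹ V) , Ω ⟩ ≈ - ⟨ V , Ω ⟩
    ⟨⟩-skew-mask V Ω skew = begin
      ⟨ Pᴸ ∘ᴹ (V ᵀ -ᴹ V) , Ω ⟩         ≈⟨ ⟨⟩-∘ Pᴸ (V ᵀ -ᴹ V) Ω ⟩
      ⟨ V ᵀ -ᴹ V , G ⟩                 ≈⟨ ⟨⟩-+ˡ (V ᵀ) (-ᴹ V) G ⟩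
      ⟨ V ᵀ , G ⟩ + ⟨ -ᴹ V , G ⟩       ≈⟨ +-cong (⟨⟩-ᵀ V G) (trans (⟨⟩-negˡ V G) (sym (⟨⟩-negʳ V G))) ⟩
      ⟨ V , G ᵀ ⟩ + ⟨ V , -ᴹ G ⟩       ≈⟨ ⟨⟩-+ʳ V (G ᵀ) (-ᴹ G) ⟨
      ⟨ V , G ᵀ -ᴹ G ⟩                 ≈⟨ ⟨⟩-congˡ V (skew-mask skew) ⟩
      ⟨ V , -ᴹ Ω ⟩                     ≈⟨ ⟨⟩-negʳ V Ω ⟩
      - ⟨ V , Ω ⟩                      ∎
      where G = Pᴸ ∘ᴹ Ω

  -- The QR pullback

  -- When QᵀQ = I, this is the orthogonal projection that annihilates the columns of Q.
  complement : ∀ {m n} → Matrix m n → Matrix m m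
  complement Q = I -ᴹ Q *ᴹ Q ᵀ

  module _ {m n : ℕ} (Q : Matrix m n) where

    complement-*ᴹ : ∀ {k} (X : Matrix m k) → complement Q *ᴹ X ≈ᴹ X -ᴹ Q *ᴹ Q ᵀ *ᴹ X
    complement-*ᴹ X = ≈ᴹ-trans (*ᴹ-distribʳ-+ᴹ X I (-ᴹ (Q *ᴹ Q ᵀ)))
      (+ᴹ-cong (*ᴹ-identityˡ X) (-ᴹ‿distribˡ-*ᴹ (Q *ᴹ Q ᵀ) X))

    complement-symmetric : complement Q ᵀ ≈ᴹ complement Q
    complement-symmetric i j = +-cong (I-symmetric i j) (-‿cong (ᵀ-*ᴹ Q (Q ᵀ) i j))

    module _ (QᵀQ≈I : Q ᵀ *ᴹ Q ≈ᴹ I) where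

      Qᵀ*complement≈0 : Q ᵀ *ᴹ complement Q ≈ᴹ 0ᴹ
      Qᵀ*complement≈0 i j = begin
        (Q ᵀ *ᴹ complement Q) i j
          ≈⟨ *ᴹ-distribˡ-+ᴹ (Q ᵀ) I (-ᴹ (Q *ᴹ Q ᵀ)) i j ⟩
        (Q ᵀ *ᴹ I) i j + (Q ᵀ *ᴹ (-ᴹ (Q *ᴹ Q ᵀ))) i j
          ≈⟨ +-cong (*ᴹ-identityʳ (Q ᵀ) i j) (-ᴹ‿distribʳ-*ᴹ (Q ᵀ) (Q *ᴹ Q ᵀ) i j) ⟩
        (Q ᵀ) i j + - (Q ᵀ *ᴹ (Q *ᴹ Q ᵀ)) i j
          ≈⟨ +-congˡ (-‿cong (*ᴹ-assoc (Q ᵀ) Q (Q ᵀ) i j)) ⟨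
        (Q ᵀ) i j + - (Q ᵀ *ᴹ Q *ᴹ Q ᵀ) i j
          ≈⟨ +-congˡ (-‿cong (≈ᴹ-trans (*ᴹ-congʳ (Q ᵀ) QᵀQ≈I) (*ᴹ-identityˡ (Q ᵀ)) i j)) ⟩
        (Q ᵀ) i j + - (Q ᵀ) i j
          ≈⟨ -‿inverseʳ _ ⟩
        0# ∎

      -- E² = E - Q(QᵀE), and QᵀE = 0.
      complement-idempotent : complement Q *ᴹ complement Q ≈ᴹ complement Q
      complement-idempotent i j = begin
        (E *ᴹ E) i j                        ≈⟨ complement-*ᴹ E i j ⟩
        E i j + - (Q *ᴹ Q ᵀ *ᴹ E) i j       ≈⟨ +-congˡ (-‿cong (*ᴹ-assoc Q (Q ᵀ) E i j)) ⟩
        E i j + - (Q *ᴹ (Q ᵀ *ᴹ E)) i j     ≈⟨ +-congˡ (-‿cong (*ᴹ-congˡ Q Qᵀ*complement≈0 i j)) ⟩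
        E i j + - (Q *ᴹ 0ᴹ) i j             ≈⟨ +-congˡ (-‿cong (*ᴹ-zeroʳ {n = m} Q i j)) ⟩
        E i j + - 0#                        ≈⟨ +-congˡ -0#≈0# ⟩
        E i j + 0#                          ≈⟨ +-identityʳ _ ⟩
        E i j                               ∎
        where E = complement Q

  -- The bracket factors as (I - QQᵀ)Q̄.
  normal-term-vanishes : ∀ {m n} (Q Q̄ : Matrix m n) (S : Matrix n n) →
    complement Q ≈ᴹ 0ᴹ → (Q̄ -ᴹ Q *ᴹ Q ᵀ *ᴹ Q̄) *ᴹ S ᵀ ≈ᴹ 0ᴹ
  normal-term-vanishes {m} Q Q̄ S E≈0 = ≈ᴹ-trans
    (*ᴹ-congʳ (S ᵀ)
      (≈ᴹ-trans (≈ᴹ-sym (complement-*ᴹ Q Q̄))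
        (≈ᴹ-trans (*ᴹ-congʳ Q̄ E≈0) (*ᴹ-zeroˡ {m} Q̄))))
    (*ᴹ-zeroˡ {m} (S ᵀ))

  -- Squareness gives the identity in I - QQᵀ and the one in QᵀQ = I the same size, so their traces
  -- cancel.
  square-complement-norm : ∀ {n} (Q : Matrix n n) → Q ᵀ *ᴹ Q ≈ᴹ I →
    ⟨ complement Q , complement Q ⟩ ≈ 0#
  square-complement-norm {n} Q QᵀQ≈I = begin
    tr (E ᵀ *ᴹ E)              ≈⟨ tr-cong (≈ᴹ-trans (*ᴹ-congʳ E (complement-symmetric Q))
                                            (complement-idempotent Q QᵀQ≈I)) ⟩
    tr E                       ≈⟨ ∑-distrib-+ {n} (λ i → I {n} i i) (λ i → - (Q *ᴹ Q ᵀ) i i) ⟩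
    tr (I {n}) + tr (-ᴹ (Q *ᴹ Q ᵀ)) ≈⟨ +-congˡ (sum-neg {n} λ i → (Q *ᴹ Q ᵀ) i i) ⟩
    tr (I {n}) + - tr (Q *ᴹ Q ᵀ)   ≈⟨ +-congˡ (-‿cong (trans (tr-comm Q (Q ᵀ)) (tr-cong QᵀQ≈I))) ⟩
    tr (I {n}) + - tr (I {n})      ≈⟨ -‿inverseʳ _ ⟩
    0#                         ∎
    where E = complement Q

  -- `S` stands for R⁻¹. The trace splits into `core`, the part of Ā along Q, and `normal`, the part
  -- orthogonal to it. The pairings of R̄Rᵀ and of QᵀQ̄ with Ω each occur with both signs and
  -- cancel, leaving the two desired terms.
  QR-pullback :
    (∀ x → x + x ≈ 0# → x ≈ 0#) →
    ∀ {m n} (Q Q̄ : Matrix m n) (R S R̄ : Matrix n n) →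
    S *ᴹ R ≈ᴹ I → R *ᴹ S ≈ᴹ I → Q ᵀ *ᴹ Q ≈ᴹ I → Pᴸ ∘ᴹ R ≈ᴹ 0ᴹ →
    ∀ (dA dQ : Matrix m n) (dR : Matrix n n) →
    dA ≈ᴹ dQ *ᴹ R +ᴹ Q *ᴹ dR → dQ ᵀ *ᴹ Q +ᴹ Q ᵀ *ᴹ dQ ≈ᴹ 0ᴹ → Pᴸ ∘ᴹ dR ≈ᴹ 0ᴹ →
    ⟨ Q *ᴹ (R̄ +ᴹ (Pᴸ ∘ᴹ (R *ᴹ R̄ ᵀ -ᴹ R̄ *ᴹ R ᵀ +ᴹ Q ᵀ *ᴹ Q̄ -ᴹ Q̄ ᵀ *ᴹ Q)) *ᴹ S ᵀ)
      +ᴹ (Q̄ -ᴹ Q *ᴹ Q ᵀ *ᴹ Q̄) *ᴹ S ᵀ , dA ⟩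
    ≈ ⟨ Q̄ , dQ ⟩ + ⟨ R̄ , dR ⟩
  QR-pullback 2-torsion-free {m} {n} Q Q̄ R S R̄ SR≈I RS≈I QᵀQ≈I R-upper dA dQ dR dA≈ dQ-skew dR-upper =
    begin
    ⟨ Q *ᴹ C +ᴹ F *ᴹ S ᵀ , dA ⟩
      ≈⟨ ⟨⟩-+ˡ (Q *ᴹ C) (F *ᴹ S ᵀ) dA ⟩
    ⟨ Q *ᴹ C , dA ⟩ + ⟨ F *ᴹ S ᵀ , dA ⟩
      ≈⟨ +-cong core normal ⟩
    ((⟨ R̄ *ᴹ R ᵀ , Ω ⟩ + ⟨ R̄ , dR ⟩) + - (⟨ R̄ *ᴹ R ᵀ , Ω ⟩ + - ⟨ Q ᵀ *ᴹ Q̄ , Ω ⟩))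
      + (⟨ Q̄ , dQ ⟩ + - ⟨ Q ᵀ *ᴹ Q̄ , Ω ⟩)
      ≈⟨ collect _ _ _ _ ⟩
    ⟨ Q̄ , dQ ⟩ + ⟨ R̄ , dR ⟩ ∎
    where
    W L C : Matrix n n
    W = R *ᴹ R̄ ᵀ -ᴹ R̄ *ᴹ R ᵀ +ᴹ Q ᵀ *ᴹ Q̄ -ᴹ Q̄ ᵀ *ᴹ Q
    L = Pᴸ ∘ᴹ W
    C = R̄ +ᴹ L *ᴹ S ᵀ

    F : Matrix m n
    F = Q̄ -ᴹ Q *ᴹ Q ᵀ *ᴹ Q̄

    V Ω U : Matrix n n
    V = R̄ *ᴹ R ᵀ -ᴹ Q ᵀ *ᴹ Q̄
    Ω = Q ᵀ *ᴹ dQ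
    U = dR *ᴹ S

    Ω-skew : Ω ᵀ +ᴹ Ω ≈ᴹ 0ᴹ
    Ω-skew i j = trans (+-congʳ (ᵀ-*ᴹ (Q ᵀ) dQ i j)) (dQ-skew i j)

    W≈Vᵀ-V : W ≈ᴹ V ᵀ -ᴹ V
    W≈Vᵀ-V i j = begin
      (((R *ᴹ R̄ ᵀ) i j + - y) + z) + - (Q̄ ᵀ *ᴹ Q) i j
        -- With this pairing the first two terms form Vᵀ and the last two form -V.
        ≈⟨ solve 4 (λ a b c d → ((a ⊕ b) ⊕ c) ⊕ d ⊜ (a ⊕ d) ⊕ (b ⊕ c)) refl _ _ _ _ ⟩
      ((R *ᴹ R̄ ᵀ) i j + - (Q̄ ᵀ *ᴹ Q) i j) + (- y + z)
        ≈⟨ +-cong (+-cong (ᵀ-*ᴹ R̄ (R ᵀ) i j) (-‿cong (ᵀ-*ᴹ (Q ᵀ) Q̄ i j)))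
                  (trans (sym (-‿+-comm y (- z))) (+-congˡ (-‿involutive z))) ⟨
      (V ᵀ -ᴹ V) i j ∎
      where
      y = (R̄ *ᴹ R ᵀ) i j
      z = (Q ᵀ *ᴹ Q̄) i j

    QᵀdA≈ : Q ᵀ *ᴹ dA ≈ᴹ Ω *ᴹ R +ᴹ dR
    QᵀdA≈ i j = begin
      (Q ᵀ *ᴹ dA) i j
        ≈⟨ *ᴹ-congˡ (Q ᵀ) dA≈ i j ⟩
      (Q ᵀ *ᴹ (dQ *ᴹ R +ᴹ Q *ᴹ dR)) i j
        ≈⟨ *ᴹ-distribˡ-+ᴹ (Q ᵀ) (dQ *ᴹ R) (Q *ᴹ dR) i j ⟩
      (Q ᵀ *ᴹ (dQ *ᴹ R)) i j + (Q ᵀ *ᴹ (Q *ᴹ dR)) i j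
        ≈⟨ +-cong (*ᴹ-assoc (Q ᵀ) dQ R i j) (*ᴹ-assoc (Q ᵀ) Q dR i j) ⟨
      (Ω *ᴹ R) i j + (Q ᵀ *ᴹ Q *ᴹ dR) i j
        ≈⟨ +-congˡ (≈ᴹ-trans (*ᴹ-congʳ dR QᵀQ≈I) (*ᴹ-identityˡ dR) i j) ⟩
      (Ω *ᴹ R) i j + dR i j ∎

    cancelR : ∀ {k} (X : Matrix k n) → X *ᴹ R *ᴹ S ≈ᴹ X
    cancelR X = ≈ᴹ-trans (*ᴹ-assoc X R S) (≈ᴹ-trans (*ᴹ-congˡ X RS≈I) (*ᴹ-identityʳ X))

    QᵀdAS≈ : (Ω *ᴹ R +ᴹ dR) *ᴹ S ≈ᴹ Ω +ᴹ U
    QᵀdAS≈ = ≈ᴹ-trans (*ᴹ-distribʳ-+ᴹ S (Ω *ᴹ R) dR) (+ᴹ-cong (cancelR Ω) (≈ᴹ-refl {x = U}))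

    dAS≈ : dA *ᴹ S ≈ᴹ dQ +ᴹ Q *ᴹ U
    dAS≈ i j = begin
      (dA *ᴹ S) i j                               ≈⟨ *ᴹ-congʳ S dA≈ i j ⟩
      ((dQ *ᴹ R +ᴹ Q *ᴹ dR) *ᴹ S) i j             ≈⟨ *ᴹ-distribʳ-+ᴹ S (dQ *ᴹ R) (Q *ᴹ dR) i j ⟩
      (dQ *ᴹ R *ᴹ S) i j + (Q *ᴹ dR *ᴹ S) i j     ≈⟨ +-cong (cancelR dQ i j) (*ᴹ-assoc Q dR S i j) ⟩
      dQ i j + (Q *ᴹ U) i j                       ∎

    U-upper : Pᴸ ∘ᴹ U ≈ᴹ 0ᴹ
    U-upper = upper⇒Pᴸ∘≈0 {X = U}
      (upper-*ᴹ {X = dR} {S} (Pᴸ∘≈0⇒upper {X = dR} dR-upper)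
        (leftInverse-upper {R = R} {S} (Pᴸ∘≈0⇒upper {X = R} R-upper) SR≈I))

    ⟨L,U⟩≈0 : ⟨ L , U ⟩ ≈ 0#
    -- The mask passes from W to the upper triangular U, which it annihilates.
    ⟨L,U⟩≈0 = trans (⟨⟩-∘ Pᴸ W U) (⟨⟩-zeroʳ W U-upper)

    ⟨L,Ω⟩≈ : ⟨ L , Ω ⟩ ≈ - (⟨ R̄ *ᴹ R ᵀ , Ω ⟩ + - ⟨ Q ᵀ *ᴹ Q̄ , Ω ⟩)
    ⟨L,Ω⟩≈ = begin
      ⟨ Pᴸ ∘ᴹ W , Ω ⟩           ≈⟨ ⟨⟩-congʳ Ω (λ i j → *-congˡ (W≈Vᵀ-V i j)) ⟩
      ⟨ Pᴸ ∘ᴹ (V ᵀ -ᴹ V) , Ω ⟩  ≈⟨ ⟨⟩-skew-mask 2-torsion-free V Ω Ω-skew ⟩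
      - ⟨ V , Ω ⟩               ≈⟨ -‿cong (⟨⟩-+ˡ (R̄ *ᴹ R ᵀ) (-ᴹ (Q ᵀ *ᴹ Q̄)) Ω) ⟩
      - (⟨ R̄ *ᴹ R ᵀ , Ω ⟩ + ⟨ -ᴹ (Q ᵀ *ᴹ Q̄) , Ω ⟩)
        ≈⟨ -‿cong (+-congˡ (⟨⟩-negˡ (Q ᵀ *ᴹ Q̄) Ω)) ⟩
      - (⟨ R̄ *ᴹ R ᵀ , Ω ⟩ + - ⟨ Q ᵀ *ᴹ Q̄ , Ω ⟩) ∎

    core : ⟨ Q *ᴹ C , dA ⟩ ≈
      (⟨ R̄ *ᴹ R ᵀ , Ω ⟩ + ⟨ R̄ , dR ⟩) + - (⟨ R̄ *ᴹ R ᵀ , Ω ⟩ + - ⟨ Q ᵀ *ᴹ Q̄ , Ω ⟩)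
    core = begin
      ⟨ Q *ᴹ C , dA ⟩
        ≈⟨ ⟨⟩-adjointˡ Q C dA ⟩
      ⟨ C , Q ᵀ *ᴹ dA ⟩
        ≈⟨ ⟨⟩-congˡ C QᵀdA≈ ⟩
      ⟨ C , T ⟩
        ≈⟨ ⟨⟩-+ˡ R̄ (L *ᴹ S ᵀ) T ⟩
      ⟨ R̄ , T ⟩ + ⟨ L *ᴹ S ᵀ , T ⟩
        -- `(S ᵀ) ᵀ` reduces to `S`, so the factor R⁻ᵀ reaches the other side as R⁻¹.
        ≈⟨ +-cong (⟨⟩-+ʳ R̄ (Ω *ᴹ R) dR) (⟨⟩-adjointʳ L (S ᵀ) T) ⟩
      (⟨ R̄ , Ω *ᴹ R ⟩ + ⟨ R̄ , dR ⟩) + ⟨ L , T *ᴹ S ⟩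
        ≈⟨ +-cong (+-congʳ (sym (⟨⟩-adjointʳ R̄ (R ᵀ) Ω)))
             (trans (⟨⟩-congˡ L QᵀdAS≈) (⟨⟩-+ʳ L Ω U)) ⟩
      (⟨ R̄ *ᴹ R ᵀ , Ω ⟩ + ⟨ R̄ , dR ⟩) + (⟨ L , Ω ⟩ + ⟨ L , U ⟩)
        ≈⟨ +-congˡ (trans (+-cong ⟨L,Ω⟩≈ ⟨L,U⟩≈0) (+-identityʳ _)) ⟩
      (⟨ R̄ *ᴹ R ᵀ , Ω ⟩ + ⟨ R̄ , dR ⟩) + - (⟨ R̄ *ᴹ R ᵀ , Ω ⟩ + - ⟨ Q ᵀ *ᴹ Q̄ , Ω ⟩) ∎
      where
      T : Matrix n n
      T = Ω *ᴹ R +ᴹ dR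

    QᵀF≈0 : Q ᵀ *ᴹ F ≈ᴹ 0ᴹ
    QᵀF≈0 i j = begin
      (Q ᵀ *ᴹ F) i j                    ≈⟨ *ᴹ-congˡ (Q ᵀ) (complement-*ᴹ Q Q̄) i j ⟨
      (Q ᵀ *ᴹ (complement Q *ᴹ Q̄)) i j  ≈⟨ *ᴹ-assoc (Q ᵀ) (complement Q) Q̄ i j ⟨
      (Q ᵀ *ᴹ complement Q *ᴹ Q̄) i j    ≈⟨ *ᴹ-congʳ Q̄ (Qᵀ*complement≈0 Q QᵀQ≈I) i j ⟩
      (0ᴹ {n} *ᴹ Q̄) i j                 ≈⟨ *ᴹ-zeroˡ {n} Q̄ i j ⟩
      0#                                ∎

    normal : ⟨ F *ᴹ S ᵀ , dA ⟩ ≈ ⟨ Q̄ , dQ ⟩ + - ⟨ Q ᵀ *ᴹ Q̄ , Ω ⟩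
    normal = begin
      ⟨ F *ᴹ S ᵀ , dA ⟩                 ≈⟨ ⟨⟩-adjointʳ F (S ᵀ) dA ⟩
      ⟨ F , dA *ᴹ S ⟩                   ≈⟨ ⟨⟩-congˡ F dAS≈ ⟩
      ⟨ F , dQ +ᴹ Q *ᴹ U ⟩              ≈⟨ ⟨⟩-+ʳ F dQ (Q *ᴹ U) ⟩
      -- Since QᵀF = 0, the component Q dR R⁻¹ of dA R⁻¹ drops out.
      ⟨ F , dQ ⟩ + ⟨ F , Q *ᴹ U ⟩       ≈⟨ +-congˡ (sym (⟨⟩-adjointˡ (Q ᵀ) F U)) ⟩
      ⟨ F , dQ ⟩ + ⟨ Q ᵀ *ᴹ F , U ⟩     ≈⟨ +-congˡ (⟨⟩-zeroˡ U QᵀF≈0) ⟩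
      ⟨ F , dQ ⟩ + 0#                   ≈⟨ +-identityʳ _ ⟩
      ⟨ F , dQ ⟩                        ≈⟨ ⟨⟩-+ˡ Q̄ (-ᴹ (Q *ᴹ Q ᵀ *ᴹ Q̄)) dQ ⟩
      ⟨ Q̄ , dQ ⟩ + ⟨ -ᴹ (Q *ᴹ Q ᵀ *ᴹ Q̄) , dQ ⟩
        ≈⟨ +-congˡ (⟨⟩-negˡ (Q *ᴹ Q ᵀ *ᴹ Q̄) dQ) ⟩
      ⟨ Q̄ , dQ ⟩ + - ⟨ Q *ᴹ Q ᵀ *ᴹ Q̄ , dQ ⟩
        ≈⟨ +-congˡ (-‿cong (trans (⟨⟩-congʳ dQ (*ᴹ-assoc Q (Q ᵀ) Q̄)) (⟨⟩-adjointˡ Q (Q ᵀ *ᴹ Q̄) dQ))) ⟩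
      ⟨ Q̄ , dQ ⟩ + - ⟨ Q ᵀ *ᴹ Q̄ , Ω ⟩   ∎

    collect : ∀ a b c d → ((a + b) + - (a + - c)) + (d + - c) ≈ d + b
    collect a b c d = begin
      ((a + b) + - (a + - c)) + (d + - c)
        ≈⟨ +-congʳ (+-congˡ (trans (sym (-‿+-comm a (- c))) (+-congˡ (-‿involutive c)))) ⟩
      ((a + b) + (- a + c)) + (d + - c)
        -- The negatives enter as separate atoms; they meet their opposites only in the next step.
        ≈⟨ solve 6 (λ a a′ b c c′ d → ((a ⊕ b) ⊕ (a′ ⊕ c)) ⊕ (d ⊕ c′) ⊜ ((a ⊕ a′) ⊕ (c ⊕ c′)) ⊕ (d ⊕ b))
             refl a (- a) b c (- c) d ⟩
      ((a + - a) + (c + - c)) + (d + b)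
        ≈⟨ +-congʳ (+-cong (-‿inverseʳ a) (-‿inverseʳ c)) ⟩
      (0# + 0#) + (d + b)
        ≈⟨ trans (+-congʳ (+-identityˡ 0#)) (+-identityˡ _) ⟩
      d + b ∎

-- A module application copies every operation of Matrices, and comparing two
-- different copies over ℝ makes the type checker unfold the arithmetic of
-- Cauchy sequences.  Binding the operations by let avoids the copies.
QRPullback : ∀ {c ℓ} → RawRing c ℓ → ℕ → ℕ → Set (c ⊔ ℓ)
QRPullback {c} {ℓ} 𝓡 M N =
    let Matrix : ℕ → ℕ → Set c
        Matrix = Matrices.Matrix 𝓡
        infix  4 _≈_ _≈ᴹ_
        infixl 6 _+_ _+ᴹ_ _-ᴹ_
        infixl 7 _*ᴹ_ _∘ᴹ_
        infix  9 _ᵀ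
        _≈_ : RawRing.Carrier 𝓡 → RawRing.Carrier 𝓡 → Set ℓ
        _≈_ = RawRing._≈_ 𝓡
        _+_ : RawRing.Carrier 𝓡 → RawRing.Carrier 𝓡 → RawRing.Carrier 𝓡
        _+_ = RawRing._+_ 𝓡
        _≈ᴹ_ : ∀ {m n} → Matrix m n → Matrix m n → Set ℓ
        _≈ᴹ_ = Matrices._≈ᴹ_ 𝓡
        0ᴹ : ∀ {m n} → Matrix m n
        0ᴹ = Matrices.0ᴹ 𝓡
        I : ∀ {n} → Matrix n n
        I = Matrices.I 𝓡
        _+ᴹ_ : ∀ {m n} → Matrix m n → Matrix m n → Matrix m n
        _+ᴹ_ = Matrices._+ᴹ_ 𝓡
        _-ᴹ_ : ∀ {m n} → Matrix m n → Matrix m n → Matrix m n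
        _-ᴹ_ = Matrices._-ᴹ_ 𝓡
        _∘ᴹ_ : ∀ {m n} → Matrix m n → Matrix m n → Matrix m n
        _∘ᴹ_ = Matrices._∘ᴹ_ 𝓡
        _*ᴹ_ : ∀ {m k n} → Matrix m k → Matrix k n → Matrix m n
        _*ᴹ_ = Matrices._*ᴹ_ 𝓡
        _ᵀ : ∀ {m n} → Matrix m n → Matrix n m
        _ᵀ = Matrices._ᵀ 𝓡
        tr : ∀ {n} → Matrix n n → RawRing.Carrier 𝓡
        tr = Matrices.tr 𝓡
        Pᴸ : ∀ {n} → Matrix n n
        Pᴸ = Matrices.Pᴸ 𝓡
        Invertible : ∀ {n} → Matrix n n → Set (c ⊔ ℓ)
        Invertible = Matrices.Invertible 𝓡
        inverse : ∀ {n} (X : Matrix n n) → Invertible X → Matrix n n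
        inverse = Matrices.inverse 𝓡
    in
    (A Q : Matrix M N) (R : Matrix N N) (R-invertible : Invertible R) →
    A ≈ᴹ Q *ᴹ R → Q ᵀ *ᴹ Q ≈ᴹ I → Pᴸ ∘ᴹ R ≈ᴹ 0ᴹ →
    (Q̄ : Matrix M N) (R̄ : Matrix N N) →
    let R⁻ᵀ = (inverse R R-invertible) ᵀ
        lastTerm = (Q̄ -ᴹ Q *ᴹ Q ᵀ *ᴹ Q̄) *ᴹ R⁻ᵀ
        Ā = Q *ᴹ (R̄ +ᴹ (Pᴸ ∘ᴹ (R *ᴹ R̄ ᵀ -ᴹ R̄ *ᴹ R ᵀ +ᴹ Q ᵀ *ᴹ Q̄ -ᴹ Q̄ ᵀ *ᴹ Q)) *ᴹ R⁻ᵀ) +ᴹ lastTerm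
    in
    (∀ (dA dQ : Matrix M N) (dR : Matrix N N) →
      dA ≈ᴹ dQ *ᴹ R +ᴹ Q *ᴹ dR →
      dQ ᵀ *ᴹ Q +ᴹ Q ᵀ *ᴹ dQ ≈ᴹ 0ᴹ →
      Pᴸ ∘ᴹ dR ≈ᴹ 0ᴹ →
      tr (Ā ᵀ *ᴹ dA) ≈ tr (Q̄ ᵀ *ᴹ dQ) + tr (R̄ ᵀ *ᴹ dR))
    × (M ≡ N → lastTerm ≈ᴹ 0ᴹ)

-- The pullback over K[t]/(t^D)

module QR {c ℓ} (K : RawRing c ℓ)
  (isCommutativeRing : IsCommutativeRing (RawRing._≈_ K)
    (RawRing._+_ K) (RawRing._*_ K) (RawRing.-_ K) (RawRing.0# K) (RawRing.1# K)) where

  open RawRing K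

  commutativeRing : CommutativeRing c ℓ
  commutativeRing = record { isCommutativeRing = isCommutativeRing }

  open CommutativeRing commutativeRing using (trans; sym; semiring)
  open SemiringSum semiring using (sum)
  open TruncatedPolynomials commutativeRing

  -- A formal-reality condition on `K`, in the double-sum form taken by the constant coefficient of
  -- a Frobenius norm.
  AnisotropicSquares : Set _
  AnisotropicSquares = ∀ {m n} (X : Fin m → Fin n → Carrier) →
    sum (λ i → sum λ j → X i j * X i j) ≈ 0# → ∀ i j → X i j ≈ 0#

  square-complement-vanishes : AnisotropicSquares → ∀ {n} D →
    let open Matrices (K [t]/t^ D) in
    (Q : Matrix n n) → Q ᵀ *ᴹ Q ≈ᴹ I → I -ᴹ Q *ᴹ Q ᵀ ≈ᴹ 0ᴹ
  -- For D = 0 there are no coefficients to compare.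
  square-complement-vanishes anisotropic ℕ.zero    Q QᵀQ≈I i j ()
  square-complement-vanishes anisotropic (ℕ.suc D) Q QᵀQ≈I =
    idempotent-vanishes (complement Q) (complement-idempotent Q QᵀQ≈I) constant≈0
    where
    open MatrixAlgebra ([t]/t^-commutativeRing (ℕ.suc D))

    constant≈0 : ∀ i j d → toℕ d ≡ 0 → complement Q i j d ≈ 0#
    constant≈0 i j zero _ = anisotropic
      -- The indices are swapped because the trace of EᵀE sums over columns on the outside.
      (λ j i → complement Q i j zero)
      (trans (sym (norm-constant (complement Q))) (square-complement-norm Q QᵀQ≈I zero))
      j i

  pullback : (∀ x → x + x ≈ 0# → x ≈ 0#) → AnisotropicSquares →
    ∀ M N D → QRPullback (K [t]/t^ D) M N
  pullback 2-torsion-free anisotropic M N D A Q R (S , SR≈I , RS≈I) _ QᵀQ≈I R-upper Q̄ R̄ =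
    QR-pullback ([t]/t^-2-torsion-free {D} 2-torsion-free)
      Q Q̄ R S R̄ SR≈I RS≈I QᵀQ≈I R-upper
    -- Matching on `M ≡ N` makes Q square, as the trace argument for I - QQᵀ = 0 requires.
    , λ { ≡.refl → normal-term-vanishes Q Q̄ S (square-complement-vanishes anisotropic D Q QᵀQ≈I) }
    where open MatrixAlgebra ([t]/t^-commutativeRing D)

mainTheorem2 :
    ∀ (M N D : ℕ) → N ≤ M → 1 ≤ N → 1 ≤ D →
    let 𝓡 = ℝ-rawRing [t]/t^ D
        Matrix : ℕ → ℕ → Set
        Matrix = Matrices.Matrix 𝓡
        infix  4 _≈_ _≈ᴹ_
        infixl 6 _+_ _+ᴹ_ _-ᴹ_
        infixl 7 _*ᴹ_ _∘ᴹ_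
        infix  9 _ᵀ
        _≈_ : RawRing.Carrier 𝓡 → RawRing.Carrier 𝓡 → Set
        _≈_ = RawRing._≈_ 𝓡
        _+_ : RawRing.Carrier 𝓡 → RawRing.Carrier 𝓡 → RawRing.Carrier 𝓡
        _+_ = RawRing._+_ 𝓡
        _≈ᴹ_ : ∀ {m n} → Matrix m n → Matrix m n → Set
        _≈ᴹ_ = Matrices._≈ᴹ_ 𝓡
        0ᴹ : ∀ {m n} → Matrix m n
        0ᴹ = Matrices.0ᴹ 𝓡
        I : ∀ {n} → Matrix n n
        I = Matrices.I 𝓡
        _+ᴹ_ : ∀ {m n} → Matrix m n → Matrix m n → Matrix m n
        _+ᴹ_ = Matrices._+ᴹ_ 𝓡
        _-ᴹ_ : ∀ {m n} → Matrix m n → Matrix m n → Matrix m n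
        _-ᴹ_ = Matrices._-ᴹ_ 𝓡
        _∘ᴹ_ : ∀ {m n} → Matrix m n → Matrix m n → Matrix m n
        _∘ᴹ_ = Matrices._∘ᴹ_ 𝓡
        _*ᴹ_ : ∀ {m k n} → Matrix m k → Matrix k n → Matrix m n
        _*ᴹ_ = Matrices._*ᴹ_ 𝓡
        _ᵀ : ∀ {m n} → Matrix m n → Matrix n m
        _ᵀ = Matrices._ᵀ 𝓡
        tr : ∀ {n} → Matrix n n → RawRing.Carrier 𝓡
        tr = Matrices.tr 𝓡
        Pᴸ : ∀ {n} → Matrix n n
        Pᴸ = Matrices.Pᴸ 𝓡
        Invertible : ∀ {n} → Matrix n n → Set
        Invertible = Matrices.Invertible 𝓡
        inverse : ∀ {n} (X : Matrix n n) → Invertible X → Matrix n n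
        inverse = Matrices.inverse 𝓡
    in
    (A Q : Matrix M N) (R : Matrix N N) (R-invertible : Invertible R) →
    A ≈ᴹ Q *ᴹ R → Q ᵀ *ᴹ Q ≈ᴹ I → Pᴸ ∘ᴹ R ≈ᴹ 0ᴹ →
    (Q̄ : Matrix M N) (R̄ : Matrix N N) →
    let R⁻ᵀ = (inverse R R-invertible) ᵀ
        lastTerm = (Q̄ -ᴹ Q *ᴹ Q ᵀ *ᴹ Q̄) *ᴹ R⁻ᵀ
        Ā = Q *ᴹ (R̄ +ᴹ (Pᴸ ∘ᴹ (R *ᴹ R̄ ᵀ -ᴹ R̄ *ᴹ R ᵀ +ᴹ Q ᵀ *ᴹ Q̄ -ᴹ Q̄ ᵀ *ᴹ Q)) *ᴹ R⁻ᵀ) +ᴹ lastTerm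
    in
    (∀ (dA dQ : Matrix M N) (dR : Matrix N N) →
      dA ≈ᴹ dQ *ᴹ R +ᴹ Q *ᴹ dR →
      dQ ᵀ *ᴹ Q +ᴹ Q ᵀ *ᴹ dQ ≈ᴹ 0ᴹ →
      Pᴸ ∘ᴹ dR ≈ᴹ 0ᴹ →
      tr (Ā ᵀ *ᴹ dA) ≈ tr (Q̄ ᵀ *ᴹ dQ) + tr (R̄ ᵀ *ᴹ dR))
    × (M ≡ N → lastTerm ≈ᴹ 0ᴹ)
mainTheorem2 M N D _ _ _ = QR.pullback ℝ-rawRing RealRing.ℝ-isCommutativeRing
  RealProperties.2-torsion-free RealProperties.∑∑squares≃0⇒≃0 M N D
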